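{- Let $d\ge1$ be an integer, let $G$ be a finite triangle-free $d$-regular graph with at least one vertex, and let $H$ be a finite graph allowing loops. Then \[ \hom(G, H)^{1/|V(G)|} \le \hom(K_{d,d}, H)^{1/(2d)}. \]
   Context: $G$ is a finite simple graph. $H$ is a finite graph which may have loops. $\hom(G,H)$ is the number of graph homomorphisms from $G$ to $H$, i.e., maps $\phi\colon V(G)\to V(H)$ such that $\phi(u)\phi(v)\in E(H)$ whenever $uv\in E(G)$ (for a looped vertex $x$, $xx\in E(H)$). $K_{d,d}$ is the complete bipartite graph with both parts of size $d$. -}

module Defs where

open import Data.Nat using (ℕ; zero; suc; _+_; _<ᵇ_)
open import Data.Bool using (Bool; true; false; _∧_; _∨_; not; if_then_else_)
open import Data.Fin using (Fin; toℕ)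
open import Data.List using (List; []; _∷_; map; concatMap; allFin)
open import Relation.Binary.PropositionalEquality using (_≡_)
open import Data.Empty using (⊥)

record SimpleGraph (n : ℕ) : Set where
  field
    adj    : Fin n → Fin n → Bool
    sym    : ∀ u v → adj u v ≡ adj v u
    irrefl : ∀ v → adj v v ≡ false

record LoopGraph (m : ℕ) : Set where
  field
    adj : Fin m → Fin m → Bool
    sym : ∀ u v → adj u v ≡ adj v u

open SimpleGraph
open LoopGraph

countTrue : List Bool → ℕ
countTrue [] = 0
countTrue (true ∷ bs) = suc (countTrue bs)
countTrue (false ∷ bs) = countTrue bs

degree : ∀ {n} → SimpleGraph n → Fin n → ℕ
degree {n} G u = countTrue (map (adj G u) (allFin n))

Regular : ∀ {n} → ℕ → SimpleGraph n → Set
Regular d G = ∀ v → degree G v ≡ d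

TriangleFree : ∀ {n} → SimpleGraph n → Set
TriangleFree G = ∀ u v w → adj G u v ≡ true → adj G v w ≡ true → adj G u w ≡ true → ⊥

allB : ∀ {A : Set} → (A → Bool) → List A → Bool
allB p [] = true
allB p (x ∷ xs) = p x ∧ allB p xs

cons : ∀ {n m} → Fin m → (Fin n → Fin m) → (Fin (suc n) → Fin m)
cons c f Fin.zero = c
cons c f (Fin.suc i) = f i

allMaps : (n m : ℕ) → List (Fin n → Fin m)
allMaps zero m = (λ ()) ∷ []
allMaps (suc n) m = concatMap (λ f → map (λ c → cons c f) (allFin m)) (allMaps n m)

isHom : ∀ {n m} → SimpleGraph n → LoopGraph m → (Fin n → Fin m) → Bool
isHom {n} G H φ = allB (λ u → allB (λ v → not (adj G u v) ∨ adj H (φ u) (φ v)) (allFin n)) (allFin n)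

hom : ∀ {n m} → SimpleGraph n → LoopGraph m → ℕ
hom {n} {m} G H = countTrue (map (isHom G H) (allMaps n m))

side : ∀ {k} → ℕ → Fin k → Bool
side d i = toℕ i <ᵇ d

xorB : Bool → Bool → Bool
xorB true b = not b
xorB false b = b

K : (d : ℕ) → SimpleGraph (d + d)
K d = record
  { adj = λ u v → xorB (side d u) (side d v)
  ; sym = λ u v → lem (side d u) (side d v)
  ; irrefl = λ v → lem2 (side d v) }
  where
  lem : ∀ a b → xorB a b ≡ xorB b a
  lem true true = _≡_.refl
  lem true false = _≡_.refl
  lem false true = _≡_.refl
  lem false false = _≡_.refl
  lem2 : ∀ a → xorB a a ≡ false
  lem2 true = _≡_.refl
  lem2 false = _≡_.refl

{-# OPTIONS --safe #-}
-- The bound is the regular case of the inequality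
--   hom(G) ≤ ∏_{u isolated} |L_u| · ∏_{uv ∈ E} hom(K_{d_u,d_v})^(1/(d_u d_v)),
-- valid for every triangle-free G and every choice of vertex weights (lists) L.  It is proved by induction:
-- sum over the colour z of a vertex w of maximum degree Δ, delete the edges at w and absorb the constraint
-- imposed by z into the weights of the neighbours of w.  As G is triangle-free, an edge that survives has at
-- most one end adjacent to w, and the sum over z is estimated by Hölder's inequality; d_v ≤ Δ is what makes
-- the exponents admissible.
--
-- All inequalities are kept free of roots: t^E ≤ ∏ a_i^(e_i) with E = ∑ e_i implies
-- (∑ t)^E ≤ ∏ (∑ a_i)^(e_i).  T is a common multiple of the possible degrees, and quot T d stands for T / d.
module Submission where

open import Defs
open import Data.Nat using (ℕ; suc; _≤_; _^_; _+_; _*_)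
open import Data.Nat using (zero; _∸_; _<_; _/_; _!; _≤?_; z≤n; s≤s; z<s; >-nonZero)
open import Data.Nat.Properties renaming (_≟_ to _≟ℕ_)
open import Data.Nat.Divisibility using (_∣_; divides; ∣-trans; m∣m*n; n∣m*n; m≤n⇒m!∣n!)
open import Data.Nat.DivMod using (m/n*n≡m)
open import Data.Nat.Tactic.RingSolver using (solve-∀)
open import Data.Bool using (Bool; true; false; _∧_; _∨_; not; if_then_else_; T)
open import Data.Bool.Properties using (∧-conicalˡ)
open import Data.Fin using (Fin; _≟_; _↑ˡ_; _↑ʳ_; toℕ)
open import Data.Fin.Properties using (toℕ-↑ˡ; toℕ-↑ʳ; toℕ<n)
open import Data.List using (List; []; _∷_; map; concatMap; allFin; _++_; length; replicate)
open import Data.List.Properties using (length-++; length-replicate; length-tabulate; map-tabulate)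
open import Data.Product using (∃; _×_; _,_; proj₁; proj₂)
open import Data.Sum using (_⊎_; inj₁; inj₂)
open import Data.Empty using (⊥-elim)
open import Function using (id)
open import Relation.Nullary using (¬_; Dec; does; yes; no; contradiction)
open import Relation.Nullary.Decidable using (dec-true; dec-false)
open import Relation.Binary.PropositionalEquality

-- Sums and products over lists

-- Deleting edges destroys regularity and conditioning on a colour changes the lists, so only the
-- irregular weighted statement can carry the induction. Take norms over colours z with weight
-- `α w`. By induction h, the count given z, satisfies h^D ≤ ∏ M_i^(e_i), where the M_i are the
-- vertex sums and biclique counts of the smaller graph. Measure M_i in the norm with exponent
-- Δ/c_i, where c_i is the number of vertices in M_i that feel z. The identity ∑ e_i c_i = D Δ is
-- what Hölder needs to bound ∑ ω h by a product of these norms. The obstacle is that a fractional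
-- power of M_i is no longer a count. Pairing M_i with a test function k is one: it adds a vertex of
-- weight ω k to one side of the biclique. Ordinary Hölder then splits that vertex off and stretches
-- a side of c_i vertices to Δ vertices, which yields the biclique of the deleted edge. This is why
-- the norms are reached by duality.

∑ : {A : Set} → List A → (A → ℕ) → ℕ
∑ []       f = 0
∑ (x ∷ xs) f = f x + ∑ xs f

∏ : {A : Set} → List A → (A → ℕ) → ℕ
∏ []       f = 1
∏ (x ∷ xs) f = f x * ∏ xs f

*-interchange : ∀ a b c d → (a * b) * (c * d) ≡ (a * c) * (b * d)
*-interchange = solve-∀

+-interchange : ∀ a b c d → (a + b) + (c + d) ≡ (a + c) + (b + d)
+-interchange = solve-∀

*-left-comm : ∀ a b c → a * (b * c) ≡ b * (a * c)
*-left-comm = solve-∀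

module _ {A : Set} where

  ∑-cong : (xs : List A) {f g : A → ℕ} → (∀ x → f x ≡ g x) → ∑ xs f ≡ ∑ xs g
  ∑-cong []       e = refl
  ∑-cong (x ∷ xs) e = cong₂ _+_ (e x) (∑-cong xs e)

  ∑-mono : (xs : List A) {f g : A → ℕ} → (∀ x → f x ≤ g x) → ∑ xs f ≤ ∑ xs g
  ∑-mono []       e = z≤n
  ∑-mono (x ∷ xs) e = +-mono-≤ (e x) (∑-mono xs e)

  ∑-+ : (xs : List A) (f g : A → ℕ) → ∑ xs (λ x → f x + g x) ≡ ∑ xs f + ∑ xs g
  ∑-+ []       f g = refl
  ∑-+ (x ∷ xs) f g = trans (cong (f x + g x +_) (∑-+ xs f g)) (+-interchange (f x) (g x) _ _)

  ∑-*ˡ : (xs : List A) (c : ℕ) (f : A → ℕ) → ∑ xs (λ x → c * f x) ≡ c * ∑ xs f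
  ∑-*ˡ []       c f = sym (*-zeroʳ c)
  ∑-*ˡ (x ∷ xs) c f = trans (cong (c * f x +_) (∑-*ˡ xs c f)) (sym (*-distribˡ-+ c (f x) _))

  ∑-*ʳ : (xs : List A) (c : ℕ) (f : A → ℕ) → ∑ xs (λ x → f x * c) ≡ ∑ xs f * c
  ∑-*ʳ xs c f = trans (∑-cong xs (λ x → *-comm (f x) c)) (trans (∑-*ˡ xs c f) (*-comm c _))

  ∑-zero : (xs : List A) → ∑ xs (λ _ → 0) ≡ 0
  ∑-zero []       = refl
  ∑-zero (x ∷ xs) = ∑-zero xs

  ∑-++ : (xs ys : List A) (f : A → ℕ) → ∑ (xs ++ ys) f ≡ ∑ xs f + ∑ ys f
  ∑-++ []       ys f = refl
  ∑-++ (x ∷ xs) ys f = trans (cong (f x +_) (∑-++ xs ys f)) (sym (+-assoc (f x) _ _))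

  ∏-cong : (xs : List A) {f g : A → ℕ} → (∀ x → f x ≡ g x) → ∏ xs f ≡ ∏ xs g
  ∏-cong []       e = refl
  ∏-cong (x ∷ xs) e = cong₂ _*_ (e x) (∏-cong xs e)

  ∏-mono : (xs : List A) {f g : A → ℕ} → (∀ x → f x ≤ g x) → ∏ xs f ≤ ∏ xs g
  ∏-mono []       e = ≤-refl
  ∏-mono (x ∷ xs) e = *-mono-≤ (e x) (∏-mono xs e)

  ∏-* : (xs : List A) (f g : A → ℕ) → ∏ xs (λ x → f x * g x) ≡ ∏ xs f * ∏ xs g
  ∏-* []       f g = refl
  ∏-* (x ∷ xs) f g = trans (cong (f x * g x *_) (∏-* xs f g)) (*-interchange (f x) (g x) _ _)

  ∏-one : (xs : List A) → ∏ xs (λ _ → 1) ≡ 1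
  ∏-one []       = refl
  ∏-one (x ∷ xs) = trans (*-identityˡ _) (∏-one xs)

  ∏-const : (xs : List A) (c : ℕ) → ∏ xs (λ _ → c) ≡ c ^ length xs
  ∏-const []       c = refl
  ∏-const (x ∷ xs) c = cong (c *_) (∏-const xs c)

  ∏-++ : (xs ys : List A) (f : A → ℕ) → ∏ (xs ++ ys) f ≡ ∏ xs f * ∏ ys f
  ∏-++ []       ys f = sym (*-identityˡ _)
  ∏-++ (x ∷ xs) ys f = trans (cong (f x *_) (∏-++ xs ys f)) (sym (*-assoc (f x) _ _))

  ∏-^∑ : (xs : List A) (c : ℕ) (f : A → ℕ) → ∏ xs (λ x → c ^ f x) ≡ c ^ ∑ xs f
  ∏-^∑ []       c f = refl
  ∏-^∑ (x ∷ xs) c f = trans (cong (c ^ f x *_) (∏-^∑ xs c f)) (sym (^-distribˡ-+-* c (f x) _))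

^-distribʳ-* : ∀ k m n → (m * n) ^ k ≡ m ^ k * n ^ k
^-distribʳ-* zero    m n = refl
^-distribʳ-* (suc k) m n = trans (cong (m * n *_) (^-distribʳ-* k m n)) (*-interchange m n _ _)

^-comm : ∀ m j k → (m ^ j) ^ k ≡ (m ^ k) ^ j
^-comm m j k = trans (^-*-assoc m j k) (trans (cong (m ^_) (*-comm j k)) (sym (^-*-assoc m k j)))

^-cancelˡ-≤ : ∀ k → 0 < k → ∀ {m n} → m ^ k ≤ n ^ k → m ≤ n
^-cancelˡ-≤ k 0<k {m} {n} le with m ≤? n
... | yes m≤n = m≤n
... | no  m≰n = contradiction le (<⇒≱ (^-monoˡ-< k {{>-nonZero 0<k}} (≰⇒> m≰n)))

0^ : ∀ {k} → 0 < k → 0 ^ k ≡ 0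
0^ (s≤s _) = refl

module _ {A B : Set} where

  ∑-map : (g : A → B) (xs : List A) (f : B → ℕ) → ∑ (map g xs) f ≡ ∑ xs (λ x → f (g x))
  ∑-map g []       f = refl
  ∑-map g (x ∷ xs) f = cong (f (g x) +_) (∑-map g xs f)

  ∏-map : (g : A → B) (xs : List A) (f : B → ℕ) → ∏ (map g xs) f ≡ ∏ xs (λ x → f (g x))
  ∏-map g []       f = refl
  ∏-map g (x ∷ xs) f = cong (f (g x) *_) (∏-map g xs f)

  ∑-concatMap : (g : A → List B) (xs : List A) (f : B → ℕ) →
                ∑ (concatMap g xs) f ≡ ∑ xs (λ x → ∑ (g x) f)
  ∑-concatMap g []       f = refl
  ∑-concatMap g (x ∷ xs) f = trans (∑-++ (g x) _ f) (cong (∑ (g x) f +_) (∑-concatMap g xs f))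

  ∏-concatMap : (g : A → List B) (xs : List A) (f : B → ℕ) →
                ∏ (concatMap g xs) f ≡ ∏ xs (λ x → ∏ (g x) f)
  ∏-concatMap g []       f = refl
  ∏-concatMap g (x ∷ xs) f = trans (∏-++ (g x) _ f) (cong (∏ (g x) f *_) (∏-concatMap g xs f))

  ∑-swap : (xs : List A) (ys : List B) (f : A → B → ℕ) →
           ∑ xs (λ x → ∑ ys (f x)) ≡ ∑ ys (λ y → ∑ xs (λ x → f x y))
  ∑-swap []       ys f = sym (∑-zero ys)
  ∑-swap (x ∷ xs) ys f = trans (cong (∑ ys (f x) +_) (∑-swap xs ys f)) (sym (∑-+ ys (f x) _))

  ∏-swap : (xs : List A) (ys : List B) (f : A → B → ℕ) →
           ∏ xs (λ x → ∏ ys (f x)) ≡ ∏ ys (λ y → ∏ xs (λ x → f x y))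
  ∏-swap []       ys f = sym (∏-one ys)
  ∏-swap (x ∷ xs) ys f = trans (cong (∏ ys (f x) *_) (∏-swap xs ys f)) (sym (∏-* ys (f x) _))

∏-^ : {A : Set} (xs : List A) (f : A → ℕ) (k : ℕ) → ∏ xs (λ x → f x ^ k) ≡ ∏ xs f ^ k
∏-^ []       f k = sym (^-zeroˡ k)
∏-^ (x ∷ xs) f k = trans (cong (f x ^ k *_) (∏-^ xs f k)) (sym (^-distribʳ-* k (f x) _))

-- Hölder's inequality without roots

-- y^(n+1) lies above its tangent line at B; the negative term is moved to the right.
tangent-≤ : ∀ n y B → suc n * (y * B ^ n) ≤ y ^ suc n + n * B ^ suc n
tangent-≤ zero    y B = ≤-reflexive (eq y)
  where eq : ∀ y → 1 * (y * 1) ≡ y * 1 + 0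
        eq = solve-∀
-- The added term completes the coefficient to 2(n + 1), so that 2yB ≤ y² + B² applies; the y² part
-- is then y times the case n.
tangent-≤ (suc n) y B = +-cancelˡ-≤ (n * (y * (B * b))) _ _ (begin
    n * (y * (B * b)) + suc (suc n) * (y * (B * b))   ≡⟨ e₁ n y B b ⟩
    (1 + n) * b * (y * B + y * B)                     ≤⟨ *-monoʳ-≤ ((1 + n) * b) (square y B) ⟩
    (1 + n) * b * (y * y + B * B)                     ≡⟨ e₂ n y B b ⟩
    y * (suc n * (y * b)) + suc n * (B * (B * b))     ≤⟨ +-monoˡ-≤ _ (*-monoʳ-≤ y (tangent-≤ n y B)) ⟩
    y * (y ^ suc n + n * (B * b)) + suc n * (B * (B * b)) ≡⟨ e₃ n y B b (y ^ suc n) ⟩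
    n * (y * (B * b)) + (y * y ^ suc n + suc n * (B * (B * b))) ∎)
  where
  open ≤-Reasoning
  b = B ^ n
  e₁ : ∀ n y B b → n * (y * (B * b)) + suc (suc n) * (y * (B * b)) ≡ (1 + n) * b * (y * B + y * B)
  e₁ = solve-∀
  e₂ : ∀ n y B b → (1 + n) * b * (y * y + B * B) ≡ y * (suc n * (y * b)) + suc n * (B * (B * b))
  e₂ = solve-∀
  e₃ : ∀ n y B b z → y * (z + n * (B * b)) + suc n * (B * (B * b))
                     ≡ n * (y * (B * b)) + (y * z + suc n * (B * (B * b)))
  e₃ = solve-∀
  square+ : ∀ a k → a * (a + k) + a * (a + k) ≤ a * a + (a + k) * (a + k)
  square+ a k = subst (a * (a + k) + a * (a + k) ≤_) (eq a k) (m≤m+n _ (k * k))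
    where eq : ∀ a k → a * (a + k) + a * (a + k) + k * k ≡ a * a + (a + k) * (a + k)
          eq = solve-∀
  square : ∀ a c → a * c + a * c ≤ a * a + c * c
  square a c with ≤-total a c
  ... | inj₁ a≤c = subst (λ v → a * v + a * v ≤ a * a + v * v) (m+[n∸m]≡n a≤c) (square+ a (c ∸ a))
  ... | inj₂ c≤a = subst₂ _≤_ (cong₂ _+_ (*-comm c a) (*-comm c a)) (+-comm (c * c) (a * a))
                     (subst (λ v → c * v + c * v ≤ c * c + v * v) (m+[n∸m]≡n c≤a) (square+ c (a ∸ c)))

-- Up to the factor n(n + 1), `B` is the mean of the tail and `y` the mean of the whole list. The
-- tangent of the power n + 1 at the old mean, evaluated at the new one, is the first entry times
-- the n-th power of the old mean.
am-gm : {A : Set} (xs : List A) (f : A → ℕ) →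
        length xs ^ length xs * ∏ xs f ≤ ∑ xs f ^ length xs
am-gm []           f = ≤-refl
am-gm (x ∷ [])     f = ≤-reflexive (eq (f x))
  where eq : ∀ a → 1 * (a * 1) ≡ (a + 0) * 1
        eq = solve-∀
am-gm (x ∷ xs@(_ ∷ xs′)) f =
  *-cancelʳ-≤ _ _ (n ^ suc n) {{m^n≢0 n (suc n)}} (+-cancelˡ-≤ (n * B ^ suc n) _ _ (begin
    n * B ^ suc n + suc n ^ suc n * (f x * p) * n ^ suc n
      ≡⟨ cong (n * B ^ suc n +_) (e₁ n (suc n ^ n) (f x) p (n ^ n)) ⟩
    n * B ^ suc n + suc n * n * f x * (suc n ^ n * (n ^ n * p))
      ≤⟨ +-monoʳ-≤ (n * B ^ suc n) (*-monoʳ-≤ (suc n * n * f x) (*-monoʳ-≤ (suc n ^ n) (am-gm xs f))) ⟩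
    n * B ^ suc n + suc n * n * f x * (suc n ^ n * s ^ n)
      ≡⟨ cong (λ v → n * B ^ suc n + suc n * n * f x * v) (sym (^-distribʳ-* n (suc n) s)) ⟩
    n * B ^ suc n + suc n * n * f x * B ^ n
      ≡⟨ e₂ n s (f x) (B ^ n) ⟩
    suc n * (y * B ^ n)
      ≤⟨ tangent-≤ n y B ⟩
    y ^ suc n + n * B ^ suc n
      ≡⟨ +-comm (y ^ suc n) _ ⟩
    n * B ^ suc n + y ^ suc n
      ≡⟨ cong (n * B ^ suc n +_) (^-distribʳ-* (suc n) (f x + s) n) ⟩
    n * B ^ suc n + (f x + s) ^ suc n * n ^ suc n ∎))
  where
  open ≤-Reasoning
  n = suc (length xs′)
  p = ∏ xs f
  s = ∑ xs f
  B = suc n * s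
  y = (f x + s) * n
  e₁ : ∀ n c a p d → (1 + n) * c * (a * p) * (n * d) ≡ (1 + n) * n * a * (c * (d * p))
  e₁ = solve-∀
  e₂ : ∀ n s a c → n * ((1 + n) * s * c) + (1 + n) * n * a * c ≡ (1 + n) * ((a + s) * n * c)
  e₂ = solve-∀

-- The value at 0 is a placeholder: in the exponents of an isolated vertex it is multiplied by 0.
quot : ℕ → ℕ → ℕ
quot N zero    = 0
quot N (suc c) = N / suc c

quot-* : ∀ {N c} → 0 < N → c ∣ N → quot N c * c ≡ N
quot-* {N} {zero}  0<N (divides k eq) = contradiction (trans eq (*-zeroʳ k)) (>⇒≢ 0<N)
quot-* {N} {suc c} 0<N c∣N            = m/n*n≡m c∣N

module _ {A : Set} where

  ∏-quot : (xs : List A) (c : A → ℕ) {N : ℕ} → 0 < N → ∏ xs c ∣ N →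
           ∏ xs (λ x → quot N (c x)) * ∏ xs c ≡ N ^ length xs
  ∏-quot []       c 0<N d = refl
  ∏-quot (x ∷ xs) c {N} 0<N d = trans (*-interchange (quot N (c x)) _ (c x) _)
    (cong₂ _*_ (quot-* {c = c x} 0<N (∣-trans (m∣m*n _) d)) (∏-quot xs c 0<N (∣-trans (n∣m*n (c x)) d)))

  ∑-quot : (xs : List A) (a b : A → ℕ) {N : ℕ} → 0 < N → ∏ xs (λ x → a x + b x) ∣ N →
           ∑ xs (λ x → a x * quot N (a x + b x)) + ∑ xs (λ x → b x * quot N (a x + b x)) ≡ length xs * N
  ∑-quot []       a b 0<N d = refl
  ∑-quot (x ∷ xs) a b {N} 0<N d = begin
      (a x * q + _) + (b x * q + _) ≡⟨ +-interchange (a x * q) _ (b x * q) _ ⟩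
      (a x * q + b x * q) + _       ≡⟨ cong₂ _+_ head (∑-quot xs a b 0<N (∣-trans (n∣m*n (a x + b x)) d)) ⟩
      N + length xs * N             ∎
    where
    open ≡-Reasoning
    q = quot N (a x + b x)
    head : a x * q + b x * q ≡ N
    head = trans (sym (*-distribʳ-+ q (a x) (b x)))
             (trans (*-comm (a x + b x) q) (quot-* {c = a x + b x} 0<N (∣-trans (m∣m*n _) d)))

  -- AM-GM for the numbers a x / c x, with denominators cleared by ∏ c: their mean dominates g / H.
  mean-bound : (xs : List A) (a c : A → ℕ) {K g H : ℕ} → 0 < length xs → 0 < ∏ xs c →
               g ^ length xs ≤ K * ∏ xs a → K * ∏ xs c < H ^ length xs →
               let s = ∑ xs (λ x → a x * quot (∏ xs c) (c x)) in
               length xs * ∏ xs c * g ≤ s * H × (0 < s → length xs * ∏ xs c * g < s * H)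
  mean-bound xs a c {K} {g} {H} 0<D 0<C g≤ C<H = weak , strict
    where
    D = length xs
    C = ∏ xs c
    q = λ x → quot C (c x)
    s = ∑ xs (λ x → a x * q x)
    instance D≢0 = >-nonZero 0<D
    Q = ∏ xs q
    Q*C : Q * C ≡ C ^ D
    Q*C = ∏-quot xs c 0<C (divides 1 (sym (*-identityˡ C)))
    power : (D * C * g) ^ D ≤ s ^ D * (K * C)
    power = begin
      (D * C * g) ^ D                 ≡⟨ trans (^-distribʳ-* D (D * C) g) (cong (_* g ^ D) (^-distribʳ-* D D C)) ⟩
      D ^ D * C ^ D * g ^ D           ≤⟨ *-monoʳ-≤ (D ^ D * C ^ D) g≤ ⟩
      D ^ D * C ^ D * (K * ∏ xs a)    ≡⟨ cong (λ v → D ^ D * v * (K * ∏ xs a)) (sym Q*C) ⟩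
      D ^ D * (Q * C) * (K * ∏ xs a)  ≡⟨ eq (D ^ D) Q C K (∏ xs a) ⟩
      D ^ D * (∏ xs a * Q) * (K * C)  ≡⟨ cong (λ v → D ^ D * v * (K * C)) (sym (∏-* xs a q)) ⟩
      D ^ D * ∏ xs (λ x → a x * q x) * (K * C) ≤⟨ *-monoˡ-≤ (K * C) (am-gm xs (λ x → a x * q x)) ⟩
      s ^ D * (K * C)                 ∎
      where
      open ≤-Reasoning
      eq : ∀ d q c k a → d * (q * c) * (k * a) ≡ d * (a * q) * (k * c)
      eq = solve-∀
    weak : D * C * g ≤ s * H
    weak = ^-cancelˡ-≤ D 0<D (≤-trans power
      (≤-trans (*-monoʳ-≤ (s ^ D) (<⇒≤ C<H)) (≤-reflexive (sym (^-distribʳ-* D s H)))))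
    strict : 0 < s → D * C * g < s * H
    strict 0<s = ≰⇒> λ le → <⇒≱
      (<-≤-trans (*-monoʳ-< (s ^ D) {{m^n≢0 s D {{>-nonZero 0<s}}}} C<H) (≤-reflexive (sym (^-distribʳ-* D s H))))
      (≤-trans (^-monoˡ-≤ D le) power)

  -- With c = a + b, AM-GM bounds g/(g + h) and h/(g + h) by the means of a/c and b/c, which add up
  -- to 1. If the claim failed, `mean-bound` would make one of the two bounds strict.
  geometric-mean-superadditive : (xs : List A) (a b : A → ℕ) {K g h : ℕ} → 0 < length xs →
    g ^ length xs ≤ K * ∏ xs a → h ^ length xs ≤ K * ∏ xs b →
    (g + h) ^ length xs ≤ K * ∏ xs (λ x → a x + b x)
  geometric-mean-superadditive xs a b {K} {g} {h} 0<D g≤ h≤ with ∏ xs (λ x → a x + b x) in C≡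
  -- Some a x + b x is 0, which forces g and h to vanish. Otherwise the product is positive and
  -- serves as the common denominator.
  ... | zero = ≤-trans (≤-reflexive (trans (cong₂ (λ u v → (u + v) ^ D) g≡0 h≡0) (0^ 0<D))) z≤n
    where
    D = length xs
    vanish : ∀ {f t} → (∀ x → f x ≤ a x + b x) → t ^ D ≤ K * ∏ xs f → t ≡ 0
    vanish {f} {t} f≤ t≤ = m^n≡0⇒m≡0 t D (n≤0⇒n≡0 (≤-trans t≤
      (≤-trans (*-monoʳ-≤ K (∏-mono xs f≤)) (≤-reflexive (trans (cong (K *_) C≡) (*-zeroʳ K))))))
    g≡0 = vanish (λ x → m≤m+n (a x) (b x)) g≤
    h≡0 = vanish (λ x → m≤n+m (b x) (a x)) h≤
  ... | suc C′ = subst (λ C → (g + h) ^ D ≤ K * C) C≡ (≮⇒≥ impossible)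
    where
    open ≤-Reasoning
    D = length xs
    c = λ x → a x + b x
    C = ∏ xs c
    0<C : 0 < C
    0<C = subst (0 <_) (sym C≡) z<s
    s = ∑ xs (λ x → a x * quot C (c x))
    t = ∑ xs (λ x → b x * quot C (c x))
    s+t : s + t ≡ D * C
    s+t = ∑-quot xs a b 0<C (divides 1 (sym (*-identityˡ C)))
    impossible : ¬ (K * C < (g + h) ^ D)
    impossible C<H = n≮n (D * C * (g + h)) (begin-strict
        D * C * (g + h)           ≡⟨ *-distribˡ-+ (D * C) g h ⟩
        D * C * g + D * C * h     <⟨ add ⟩
        s * (g + h) + t * (g + h) ≡⟨ sym (*-distribʳ-+ (g + h) s t) ⟩
        (s + t) * (g + h)         ≡⟨ cong (_* (g + h)) s+t ⟩
        D * C * (g + h)           ∎)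
      where
      G = mean-bound xs a c {K} {H = g + h} 0<D 0<C g≤ C<H
      H = mean-bound xs b c {K} {H = g + h} 0<D 0<C h≤ C<H
      add : D * C * g + D * C * h < s * (g + h) + t * (g + h)
      -- `s` and `t` add up to D * C > 0, so at least one of the strict bounds is available.
      add with s in s≡
      ... | suc _ = +-mono-<-≤ (subst (λ v → D * C * g < v * (g + h)) s≡ (proj₂ G (subst (0 <_) (sym s≡) z<s))) (proj₁ H)
      ... | zero  = +-mono-≤-< (subst (λ v → D * C * g ≤ v * (g + h)) s≡ (proj₁ G))
                      (proj₂ H (subst (0 <_) (trans (sym s+t) (cong (_+ t) s≡)) (*-mono-≤ 0<D 0<C)))

-- Superadditivity of the geometric mean is the two-term case; the sum is built up one term at a
-- time.
hölder-unweighted : {A J : Set} (xs : List A) (js : List J) → 0 < length js →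
  (t : A → ℕ) (a : J → A → ℕ) (K : ℕ) →
  (∀ x → t x ^ length js ≤ K * ∏ js (λ j → a j x)) →
  ∑ xs t ^ length js ≤ K * ∏ js (λ j → ∑ xs (a j))
hölder-unweighted []       js 0<D t a K le = ≤-trans (≤-reflexive (0^ 0<D)) z≤n
hölder-unweighted (x ∷ xs) js 0<D t a K le =
  geometric-mean-superadditive js (λ j → a j x) (λ j → ∑ xs (a j)) {K} 0<D (le x)
    (hölder-unweighted xs js 0<D t a K le)

-- Integer exponents are multiplicities: each index is repeated `e i` times.
hölder : {A I : Set} (xs : List A) (is : List I) (e : I → ℕ) → 0 < ∑ is e →
  (t : A → ℕ) (a : I → A → ℕ) (K : ℕ) →
  (∀ x → t x ^ ∑ is e ≤ K * ∏ is (λ i → a i x ^ e i)) →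
  ∑ xs t ^ ∑ is e ≤ K * ∏ is (λ i → ∑ xs (a i) ^ e i)
hölder xs is e 0<E t a K le =
  subst₂ (λ D p → ∑ xs t ^ D ≤ K * p) (length-js is) (∏-js is _)
    (hölder-unweighted xs (js is) (subst (0 <_) (sym (length-js is)) 0<E) t a K
      (λ x → subst₂ (λ D p → t x ^ D ≤ K * p) (sym (length-js is)) (sym (∏-js is _)) (le x)))
  where
  js : List _ → List _
  js = concatMap (λ i → replicate (e i) i)
  length-js : ∀ is → length (js is) ≡ ∑ is e
  length-js []       = refl
  length-js (i ∷ is) = trans (length-++ (replicate (e i) i)) (cong₂ _+_ (length-replicate (e i)) (length-js is))
  ∏-replicate : ∀ k i (f : _ → ℕ) → ∏ (replicate k i) f ≡ f i ^ k
  ∏-replicate zero    i f = refl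
  ∏-replicate (suc k) i f = cong (f i *_) (∏-replicate k i f)
  ∏-js : ∀ is (f : _ → ℕ) → ∏ (js is) f ≡ ∏ is (λ i → f i ^ e i)
  ∏-js is f = trans (∏-concatMap _ is f) (∏-cong is (λ i → ∏-replicate (e i) i f))

hölder₂ : {A : Set} (xs : List A) (p r : ℕ) → 0 < p + r → (t a b : A → ℕ) (K : ℕ) →
  (∀ x → t x ^ (p + r) ≤ K * (a x ^ p * b x ^ r)) →
  ∑ xs t ^ (p + r) ≤ K * (∑ xs a ^ p * ∑ xs b ^ r)
hölder₂ xs p r 0<D t a b K le =
  subst₂ (λ D v → ∑ xs t ^ D ≤ K * (∑ xs a ^ p * v)) (cong (p +_) (+-identityʳ r)) (*-identityʳ _)
    (hölder xs (true ∷ false ∷ []) (λ i → if i then p else r)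
      (subst (0 <_) (sym (cong (p +_) (+-identityʳ r))) 0<D) t (λ i → if i then a else b) K
      (λ x → subst₂ (λ D v → t x ^ D ≤ K * (a x ^ p * v))
               (sym (cong (p +_) (+-identityʳ r))) (sym (*-identityʳ _)) (le x)))

-- Integer roots and the removal of rounding errors

iroot : ∀ k → 0 < k → ∀ N → ∃ λ r → r ^ k ≤ N × N < suc r ^ k
iroot k 0<k zero = 0 , ≤-reflexive (0^ 0<k) , ≤-reflexive (sym (^-zeroˡ k))
iroot k 0<k (suc N) with iroot k 0<k N
... | r , r^k≤N , N<  with suc r ^ k ≤? suc N
...   | yes le = suc r , le , ≤-<-trans N< (^-monoˡ-< k {{>-nonZero 0<k}} (n<1+n (suc r)))
...   | no  ≰  = r , m≤n⇒m≤1+n r^k≤N , ≰⇒> ≰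

-- Division by (L + 1)^(p + 1) gives the usual form (1 - 1/(L + 1))^p ≥ 1 - p/(L + 1).
bernoulli : ∀ p L → suc L ^ suc p ≤ suc L * L ^ p + p * suc L ^ p
bernoulli zero    L = ≤-reflexive (sym (+-identityʳ _))
bernoulli (suc p) L = begin
    B ^ suc p + L * B ^ suc p                  ≤⟨ +-monoʳ-≤ (B ^ suc p) (*-monoʳ-≤ L (bernoulli p L)) ⟩
    B ^ suc p + L * (B * L ^ p + p * B ^ p)    ≡⟨ e₁ (B ^ suc p) L B (L ^ p) p (B ^ p) ⟩
    B * (L * L ^ p) + (B ^ suc p + p * (L * B ^ p))
      ≤⟨ +-monoʳ-≤ (B * (L * L ^ p)) (+-monoʳ-≤ (B ^ suc p) (*-monoʳ-≤ p (*-monoˡ-≤ (B ^ p) (n≤1+n L)))) ⟩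
    B * (L * L ^ p) + (B ^ suc p + p * B ^ suc p) ∎
  where
  open ≤-Reasoning
  B = suc L
  e₁ : ∀ z L B l p b → z + L * (B * l + p * b) ≡ B * (L * l) + (z + p * (L * b))
  e₁ = solve-∀

-- L^p / (L+1)^p → 1 as L → ∞.
≤-limit : ∀ p {X Y} → (∀ L → 0 < L → L ^ p * X ≤ suc L ^ p * Y) → X ≤ Y
≤-limit p {X} {Y} le = ≮⇒≥ λ Y<X → <⇒≱ (s≤s (≤-refl {L}))
  (*-cancelʳ-≤ B L (B ^ p) {{m^n≢0 B p}} (begin
    B * B ^ p                        ≤⟨ bernoulli p L ⟩
    B * L ^ p + p * B ^ p            ≤⟨ +-monoˡ-≤ (p * B ^ p) (gap Y<X) ⟩
    p * Y * B ^ p + p * B ^ p        ≤⟨ m≤n+m _ (B ^ p) ⟩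
    B ^ p + (p * Y * B ^ p + p * B ^ p) ≡⟨ e₁ (B ^ p) p Y ⟩
    L * B ^ p                        ∎))
  where
  open ≤-Reasoning
  -- If Y < X, the hypothesis and Bernoulli force L + 1 ≤ pY + p, which fails from L = pY + p on;
  -- the `suc` keeps L positive.
  L = suc (p * Y + p)
  B = suc L
  e₁ : ∀ b p Y → b + (p * Y * b + p * b) ≡ suc (p * Y + p) * b
  e₁ = solve-∀
  e₂ : ∀ B l Y → B * (l * Y) + B * l ≡ B * (l * suc Y)
  e₂ = solve-∀
  e₃ : ∀ B l p b Y → Y * (B * l + p * b) ≡ B * (l * Y) + p * Y * b
  e₃ = solve-∀
  gap : Y < X → B * L ^ p ≤ p * Y * B ^ p
  gap Y<X = +-cancelˡ-≤ (B * (L ^ p * Y)) _ _ (begin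
    B * (L ^ p * Y) + B * L ^ p   ≡⟨ e₂ B (L ^ p) Y ⟩
    B * (L ^ p * suc Y)           ≤⟨ *-monoʳ-≤ B (≤-trans (*-monoʳ-≤ (L ^ p) Y<X) (le L z<s)) ⟩
    B * (B ^ p * Y)               ≡⟨ trans (sym (*-assoc B (B ^ p) Y)) (*-comm (B ^ suc p) Y) ⟩
    Y * B ^ suc p                 ≤⟨ *-monoʳ-≤ Y (bernoulli p L) ⟩
    Y * (B * L ^ p + p * B ^ p)   ≡⟨ e₃ B (L ^ p) p (B ^ p) Y ⟩
    B * (L ^ p * Y) + p * Y * B ^ p ∎)

-- Weighted homomorphisms from complete bipartite graphs

allFin-suc : ∀ n → allFin (suc n) ≡ Fin.zero ∷ map Fin.suc (allFin n)
allFin-suc n = cong (Fin.zero ∷_) (sym (map-tabulate id Fin.suc))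

∏-allFin-suc : ∀ {n} (f : Fin (suc n) → ℕ) →
               ∏ (allFin (suc n)) f ≡ f Fin.zero * ∏ (allFin n) (λ u → f (Fin.suc u))
∏-allFin-suc {n} f = trans (cong (λ us → ∏ us f) (allFin-suc n)) (cong (f Fin.zero *_) (∏-map Fin.suc (allFin n) f))

∏-allFin-const : ∀ n c → ∏ (allFin n) (λ _ → c) ≡ c ^ n
∏-allFin-const n c = trans (∏-const (allFin n) c) (cong (c ^_) (length-tabulate {n = n} id))

module _ {m : ℕ} where

  ∑-allMaps-suc : ∀ {n} (F : (Fin (suc n) → Fin m) → ℕ) →
    ∑ (allMaps (suc n) m) F ≡ ∑ (allMaps n m) (λ φ → ∑ (allFin m) (λ c → F (cons c φ)))
  ∑-allMaps-suc {n} F = trans (∑-concatMap _ (allMaps n m) F)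
    (∑-cong (allMaps n m) (λ φ → ∑-map (λ c → cons c φ) (allFin m) F))

  ∑-allMaps-∏ : ∀ n (f : Fin n → Fin m → ℕ) →
    ∑ (allMaps n m) (λ φ → ∏ (allFin n) (λ u → f u (φ u))) ≡ ∏ (allFin n) (λ u → ∑ (allFin m) (f u))
  ∑-allMaps-∏ zero    f = refl
  ∑-allMaps-∏ (suc n) f = begin
      ∑ (allMaps (suc n) m) (λ φ → ∏ (allFin (suc n)) (λ u → f u (φ u)))
        ≡⟨ ∑-allMaps-suc {n} _ ⟩
      ∑ (allMaps n m) (λ φ → ∑ (allFin m) (λ c → ∏ (allFin (suc n)) (λ u → f u (cons c φ u))))
        ≡⟨ ∑-cong (allMaps n m) (λ φ → ∑-cong (allFin m) (λ c → ∏-allFin-suc (λ u → f u (cons c φ u)))) ⟩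
      ∑ (allMaps n m) (λ φ → ∑ (allFin m) (λ c → f Fin.zero c * ∏ (allFin n) (λ u → f (Fin.suc u) (φ u))))
        ≡⟨ ∑-cong (allMaps n m) (λ φ → ∑-*ʳ (allFin m) _ (f Fin.zero)) ⟩
      ∑ (allMaps n m) (λ φ → ∑ (allFin m) (f Fin.zero) * ∏ (allFin n) (λ u → f (Fin.suc u) (φ u)))
        ≡⟨ ∑-*ˡ (allMaps n m) (∑ (allFin m) (f Fin.zero)) _ ⟩
      ∑ (allFin m) (f Fin.zero) * ∑ (allMaps n m) (λ φ → ∏ (allFin n) (λ u → f (Fin.suc u) (φ u)))
        ≡⟨ cong (∑ (allFin m) (f Fin.zero) *_) (∑-allMaps-∏ n (λ u → f (Fin.suc u))) ⟩
      ∑ (allFin m) (f Fin.zero) * ∏ (allFin n) (λ u → ∑ (allFin m) (f (Fin.suc u)))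
        ≡⟨ sym (∏-allFin-suc (λ u → ∑ (allFin m) (f u))) ⟩
      ∏ (allFin (suc n)) (λ u → ∑ (allFin m) (f u)) ∎
    where open ≡-Reasoning

  ∑-allMaps-^ : ∀ n (f : Fin m → ℕ) →
    ∑ (allMaps n m) (λ φ → ∏ (allFin n) (λ u → f (φ u))) ≡ ∑ (allFin m) f ^ n
  ∑-allMaps-^ n f = trans (∑-allMaps-∏ n (λ _ → f)) (∏-allFin-const n (∑ (allFin m) f))

  module Biclique (a : Fin m → Fin m → ℕ) (a-sym : ∀ x y → a x y ≡ a y x) where

    -- The weighted number of choices for one vertex of the other side when the tuple x is fixed.
    -- `W` takes its s-th power because the s vertices there are then coloured independently.
    Common : ∀ {p} → (Fin m → ℕ) → (Fin p → Fin m) → ℕ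
    Common {p} β x = ∑ (allFin m) (λ y → β y * ∏ (allFin p) (λ i → a (x i) y))

    -- Weighted homomorphisms from K_{p,s}, with p vertices of weight α and s of weight β.
    W : (α β : Fin m → ℕ) (p s : ℕ) → ℕ
    W α β p s = ∑ (allMaps p m) (λ x → ∏ (allFin p) (λ i → α (x i)) * Common β x ^ s)

    W-cong : ∀ {α α′ β β′} p s → (∀ x → α x ≡ α′ x) → (∀ x → β x ≡ β′ x) → W α β p s ≡ W α′ β′ p s
    W-cong p s α≡ β≡ = ∑-cong (allMaps p m) (λ x → cong₂ (λ u v → u * v ^ s)
      (∏-cong (allFin p) (λ i → α≡ (x i)))
      (∑-cong (allFin m) (λ y → cong (_* _) (β≡ y))))

    -- Restores the second side, which `W` has summed out; only in this form do both sides look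
    -- alike.
    W-expand : ∀ α β p s → W α β p s ≡ ∑ (allMaps p m) (λ x → ∑ (allMaps s m) (λ y →
      ∏ (allFin p) (λ i → α (x i)) * (∏ (allFin s) (λ j → β (y j)) *
        ∏ (allFin s) (λ j → ∏ (allFin p) (λ i → a (x i) (y j))))))
    W-expand α β p s = ∑-cong (allMaps p m) (λ x → begin
        ∏ (allFin p) (λ i → α (x i)) * Common β x ^ s
          ≡⟨ cong (∏ (allFin p) (λ i → α (x i)) *_) (sym (∑-allMaps-^ s _)) ⟩
        ∏ (allFin p) (λ i → α (x i)) *
          ∑ (allMaps s m) (λ y → ∏ (allFin s) (λ j → β (y j) * ∏ (allFin p) (λ i → a (x i) (y j))))
          ≡⟨ sym (∑-*ˡ (allMaps s m) (∏ (allFin p) (λ i → α (x i))) _) ⟩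
        ∑ (allMaps s m) (λ y → ∏ (allFin p) (λ i → α (x i)) *
          ∏ (allFin s) (λ j → β (y j) * ∏ (allFin p) (λ i → a (x i) (y j))))
          ≡⟨ ∑-cong (allMaps s m) (λ y → cong (∏ (allFin p) (λ i → α (x i)) *_) (∏-* (allFin s) _ _)) ⟩
        _ ∎)
      where open ≡-Reasoning

    W-sym : ∀ α β p s → W α β p s ≡ W β α s p
    W-sym α β p s = begin
        W α β p s ≡⟨ W-expand α β p s ⟩
        _         ≡⟨ ∑-swap (allMaps p m) (allMaps s m) _ ⟩
        _         ≡⟨ ∑-cong (allMaps s m) (λ y → ∑-cong (allMaps p m) (λ x →
                       trans (*-left-comm (∏ (allFin p) (λ i → α (x i))) (∏ (allFin s) (λ j → β (y j))) _)
                         (cong (λ v → ∏ (allFin s) (λ j → β (y j)) * (∏ (allFin p) (λ i → α (x i)) * v))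
                           (trans (∏-swap (allFin s) (allFin p) _)
                             (∏-cong (allFin p) (λ i → ∏-cong (allFin s) (λ j → a-sym (x i) (y j)))))))) ⟩
        _         ≡⟨ sym (W-expand β α s p) ⟩
        W β α s p ∎
      where open ≡-Reasoning

    module _ (ω α : Fin m → ℕ) (r c : ℕ) (0<r+c : 0 < r + c) (k h : Fin m → ℕ) (L : ℕ)
             (k≤ : ∀ z → k z ^ (r + c) ≤ L ^ (r + c) * h z ^ r) where

      -- The hypothesis on k reads k ≤ L h^(r/Δ) with Δ = r + c. Hölder over b-tuples with exponents
      -- r/Δ and c/Δ splits off the values of h, whose products sum to the b-th power of ∑ ω h, and
      -- raises c common-neighbour factors to Δ of them.
      W-tilted : ∀ b → W (λ z → ω z * k z) α b c ^ (r + c) ≤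
        L ^ (b * (r + c)) * ((∑ (allFin m) (λ z → ω z * h z)) ^ (b * r) * W ω α b (r + c) ^ c)
      W-tilted b = subst (λ v → W (λ z → ω z * k z) α b c ^ Δ ≤ L ^ (b * Δ) * (v * W ω α b Δ ^ c))
          (trans (cong (_^ r) (∑-allMaps-^ b (λ z → ω z * h z))) (^-*-assoc _ b r))
          (hölder₂ (allMaps b m) r c 0<r+c _ _ _ (L ^ (b * Δ)) pointwise)
        where
        open ≤-Reasoning
        Δ = r + c
        e₁ : ∀ ωr ωc l hr → (ωr * ωc) * (l * hr) ≡ l * ((ωr * hr) * ωc)
        e₁ = solve-∀
        single : ∀ z → (ω z * k z) ^ Δ ≤ L ^ Δ * ((ω z * h z) ^ r * ω z ^ c)
        single z = begin
          (ω z * k z) ^ Δ                          ≡⟨ ^-distribʳ-* Δ (ω z) (k z) ⟩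
          ω z ^ Δ * k z ^ Δ                        ≤⟨ *-monoʳ-≤ (ω z ^ Δ) (k≤ z) ⟩
          ω z ^ Δ * (L ^ Δ * h z ^ r)              ≡⟨ cong (_* (L ^ Δ * h z ^ r)) (^-distribˡ-+-* (ω z) r c) ⟩
          ω z ^ r * ω z ^ c * (L ^ Δ * h z ^ r)    ≡⟨ e₁ (ω z ^ r) (ω z ^ c) (L ^ Δ) (h z ^ r) ⟩
          L ^ Δ * ((ω z ^ r * h z ^ r) * ω z ^ c)  ≡⟨ cong (λ v → L ^ Δ * (v * ω z ^ c)) (sym (^-distribʳ-* r (ω z) (h z))) ⟩
          L ^ Δ * ((ω z * h z) ^ r * ω z ^ c)      ∎
        bs = allFin b
        pointwise : ∀ z → (∏ bs (λ i → ω (z i) * k (z i)) * Common α z ^ c) ^ Δ ≤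
          L ^ (b * Δ) * (∏ bs (λ i → ω (z i) * h (z i)) ^ r * (∏ bs (λ i → ω (z i)) * Common α z ^ Δ) ^ c)
        pointwise z = begin
          (∏ bs (λ i → ω (z i) * k (z i)) * N ^ c) ^ Δ
            ≡⟨ ^-distribʳ-* Δ _ (N ^ c) ⟩
          ∏ bs (λ i → ω (z i) * k (z i)) ^ Δ * (N ^ c) ^ Δ
            ≡⟨ cong₂ _*_ (sym (∏-^ bs _ Δ)) (^-comm N c Δ) ⟩
          ∏ bs (λ i → (ω (z i) * k (z i)) ^ Δ) * (N ^ Δ) ^ c
            ≤⟨ *-monoˡ-≤ ((N ^ Δ) ^ c) (∏-mono bs (λ i → single (z i))) ⟩
          ∏ bs (λ i → L ^ Δ * ((ω (z i) * h (z i)) ^ r * ω (z i) ^ c)) * (N ^ Δ) ^ c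
            ≡⟨ cong (_* (N ^ Δ) ^ c) (trans (∏-* bs _ _) (cong₂ _*_ constant
                 (trans (∏-* bs _ _) (cong₂ _*_ (∏-^ bs _ r) (∏-^ bs _ c))))) ⟩
          L ^ (b * Δ) * (∏ bs (λ i → ω (z i) * h (z i)) ^ r * ∏ bs (λ i → ω (z i)) ^ c) * (N ^ Δ) ^ c
            ≡⟨ e₂ (L ^ (b * Δ)) (∏ bs (λ i → ω (z i) * h (z i)) ^ r) (∏ bs (λ i → ω (z i)) ^ c) _ ⟩
          L ^ (b * Δ) * (∏ bs (λ i → ω (z i) * h (z i)) ^ r * (∏ bs (λ i → ω (z i)) ^ c * (N ^ Δ) ^ c))
            ≡⟨ cong (λ v → L ^ (b * Δ) * (∏ bs (λ i → ω (z i) * h (z i)) ^ r * v)) (sym (^-distribʳ-* c _ (N ^ Δ))) ⟩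
          _ ∎
          where
          N = Common α z
          e₂ : ∀ l x y z → l * (x * y) * z ≡ l * (x * (y * z))
          e₂ = solve-∀
          constant : ∏ bs (λ _ → L ^ Δ) ≡ L ^ (b * Δ)
          constant = trans (∏-allFin-const b (L ^ Δ)) (trans (^-*-assoc L Δ b) (cong (L ^_) (*-comm Δ b)))

      -- Every vertex of weight α carries the factor `a z`, so summation over z adds one vertex of
      -- weight ω k to the side of β. Hölder with exponents b′/b and 1/b separates it from the b′
      -- vertices of weight β; after an exchange of sides, `W-tilted` bounds the factor of the new
      -- vertex.
      W-conditioned : ∀ β b′ → let b = suc b′ in
        ∑ (allFin m) (λ z → ω z * k z * W (λ x → α x * a z x) β c b′) ^ (b * (r + c)) ≤
        W α β c b ^ (b′ * (r + c)) *
          (L ^ (b * (r + c)) * ((∑ (allFin m) (λ z → ω z * h z)) ^ (b * r) * W ω α b (r + c) ^ c))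
      W-conditioned β b′ = begin
          P ^ (b * Δ)                     ≡⟨ sym (^-*-assoc P b Δ) ⟩
          (P ^ b) ^ Δ                     ≤⟨ ^-monoˡ-≤ Δ P^b≤ ⟩
          (W α β c b ^ b′ * Q) ^ Δ        ≡⟨ ^-distribʳ-* Δ _ Q ⟩
          (W α β c b ^ b′) ^ Δ * Q ^ Δ    ≡⟨ cong₂ _*_ (^-*-assoc _ b′ Δ) (cong (_^ Δ) (W-sym α ωk c b)) ⟩
          W α β c b ^ (b′ * Δ) * W ωk α b c ^ Δ ≤⟨ *-monoʳ-≤ (W α β c b ^ (b′ * Δ)) (W-tilted b) ⟩
          _                               ∎
        where
        open ≤-Reasoning
        Δ = r + c
        b = suc b′
        cs = allFin c
        zs = allFin m
        ωk : Fin m → ℕ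
        ωk z = ω z * k z
        P = ∑ zs (λ z → ωk z * W (λ x → α x * a z x) β c b′)
        Q = W α ωk c b
        A : (Fin c → Fin m) → ℕ
        A x = ∏ cs (λ i → α (x i))
        P≡ : P ≡ ∑ (allMaps c m) (λ x → A x * Common β x ^ b′ * Common ωk x)
        P≡ = trans (∑-cong zs (λ z → sym (∑-*ˡ (allMaps c m) (ωk z) _)))
             (trans (∑-swap zs (allMaps c m) _)
               (∑-cong (allMaps c m) (λ x →
                 trans (∑-cong zs (λ z → trans
                          (cong (λ v → ωk z * (v * Common β x ^ b′))
                            (trans (∏-* cs _ _) (cong (A x *_) (∏-cong cs (λ i → a-sym z (x i))))))
                          (e₁ (ωk z) (A x) _ (Common β x ^ b′))))
                   (∑-*ˡ zs (A x * Common β x ^ b′) _))))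
          where
          e₁ : ∀ w A g f → w * (A * g * f) ≡ A * f * (w * g)
          e₁ = solve-∀
        e₂ : ∀ A K ab kb fb → (A * ab) * fb * (K * kb) ≡ (A * (K * kb)) * (ab * fb)
        e₂ = solve-∀
        pointwise : ∀ x → (A x * Common β x ^ b′ * Common ωk x) ^ b ≡
                          1 * ((A x * Common ωk x ^ b) ^ 1 * (A x * Common β x ^ b) ^ b′)
        pointwise x = begin-equality
          (A x * F ^ b′ * κ) ^ b                      ≡⟨ trans (^-distribʳ-* b (A x * F ^ b′) κ) (cong (_* κ ^ b) (^-distribʳ-* b (A x) (F ^ b′))) ⟩
          A x ^ b * (F ^ b′) ^ b * κ ^ b              ≡⟨ cong (λ v → A x ^ b * v * κ ^ b) (^-comm F b′ b) ⟩
          A x ^ b * (F ^ b) ^ b′ * κ ^ b              ≡⟨ e₂ (A x) κ (A x ^ b′) (κ ^ b′) _ ⟩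
          A x * κ ^ b * (A x ^ b′ * (F ^ b) ^ b′)     ≡⟨ cong₂ _*_ (sym (*-identityʳ (A x * κ ^ b))) (sym (^-distribʳ-* b′ (A x) (F ^ b))) ⟩
          (A x * κ ^ b) ^ 1 * (A x * F ^ b) ^ b′      ≡⟨ sym (*-identityˡ _) ⟩
          _                                           ∎
          where
          F = Common β x
          κ = Common ωk x
        P^b≤ : P ^ b ≤ W α β c b ^ b′ * Q
        P^b≤ = begin
          P ^ b                                    ≡⟨ cong (_^ b) P≡ ⟩
          _                                        ≤⟨ hölder₂ (allMaps c m) 1 b′ z<s _ _ _ 1 (λ x → ≤-reflexive (pointwise x)) ⟩
          1 * (Q ^ 1 * W α β c b ^ b′)             ≡⟨ e₃ Q _ ⟩
          W α β c b ^ b′ * Q                       ∎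
          where
          e₃ : ∀ q w → 1 * ((q * 1) * w) ≡ w * q
          e₃ = solve-∀

-- Hölder's inequality in dual form

-- k = h^((Δ-c)/Δ) is the test function extremal for the L^(Δ/c)-norm of M i.  It is
-- irrational, so k is an integer approximation of L times this value, and L → ∞ at the end.
module Duality {A I : Set} (zs : List A) (ω h : A → ℕ) (is : List I) (e c : I → ℕ) (M : I → A → ℕ) (β : I → ℕ)
               (Δ T D : ℕ) (0<Δ : 0 < Δ) (0<T : 0 < T) (0<D : 0 < D)
               (c≤Δ : ∀ i → c i ≤ Δ)
               (h≤ : ∀ z → h z ^ D ≤ ∏ is (λ i → M i z ^ e i))
               (weights : ∑ is (λ i → e i * c i) ≡ D * Δ)
               (bound : ∀ i L (k : A → ℕ) → (∀ z → k z ^ Δ ≤ L ^ Δ * h z ^ (Δ ∸ c i)) →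
                 ∑ zs (λ z → ω z * k z * M i z) ^ (e i * (Δ * T)) ≤
                 L ^ (e i * (Δ * T)) * (∑ zs (λ z → ω z * h z) ^ ((Δ ∸ c i) * e i * T) * β i)) where

  private
    S E G : ℕ
    S = ∑ zs (λ z → ω z * h z)
    E = ∑ is e
    G = ∑ is (λ i → (Δ ∸ c i) * e i)

    -- How the exponent E of h is spent: G/Δ on the test functions and D on the bound `h≤`.
    G+DΔ : G + D * Δ ≡ E * Δ
    G+DΔ = trans (cong (G +_) (sym weights)) (trans (sym (∑-+ is _ _))
      (trans (∑-cong is (λ i → trans (eq (Δ ∸ c i) (e i) (c i)) (cong (e i *_) (m∸n+n≡m (c≤Δ i)))))
        (∑-*ʳ is Δ e)))
      where eq : ∀ g e c → g * e + e * c ≡ e * (g + c)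
            eq = solve-∀

    0<E : 0 < E
    0<E = *-cancelʳ-< Δ 0 E (<-≤-trans (*-mono-≤ 0<D 0<Δ) (≤-trans (m≤n+m (D * Δ) G) (≤-reflexive G+DΔ)))

    module Scale (L : ℕ) (0<L : 0 < L) where

      root : ∀ i z → _
      root i z = iroot Δ 0<Δ (L ^ Δ * h z ^ (Δ ∸ c i))

      k : I → A → ℕ
      k i z = proj₁ (root i z)

      -- Rounding the root down costs at most the factor (L + 1)/L: for h z > 0 the root κ is at
      -- least L, hence L(κ + 1) ≤ (L + 1)κ.
      k-lower : ∀ i z → 0 < h z → (L * L) ^ Δ * h z ^ (Δ ∸ c i) ≤ (suc L * k i z) ^ Δ
      k-lower i z 0<h = begin
          (L * L) ^ Δ * H          ≡⟨ trans (cong (_* H) (^-distribʳ-* Δ L L)) (*-assoc (L ^ Δ) _ H) ⟩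
          L ^ Δ * (L ^ Δ * H)      ≤⟨ *-monoʳ-≤ (L ^ Δ) (<⇒≤ (proj₂ (proj₂ (root i z)))) ⟩
          L ^ Δ * suc κ ^ Δ        ≡⟨ sym (^-distribʳ-* Δ L (suc κ)) ⟩
          (L * suc κ) ^ Δ          ≤⟨ ^-monoˡ-≤ Δ (≤-trans (≤-reflexive (*-suc L κ)) (+-monoˡ-≤ (L * κ) L≤κ)) ⟩
          (suc L * κ) ^ Δ          ∎
        where
        open ≤-Reasoning
        κ = k i z
        H = h z ^ (Δ ∸ c i)
        L≤κ : L ≤ κ
        L≤κ = ≮⇒≥ λ κ<L → <⇒≱ (proj₂ (proj₂ (root i z)))
          (≤-trans (^-monoˡ-≤ Δ κ<L) (m≤m*n (L ^ Δ) H {{m^n≢0 (h z) (Δ ∸ c i) {{>-nonZero 0<h}}}}))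

      -- One factor L is the scale of `k`; the other, against `suc L`, pays for the rounding.
      h-power : ∀ z → (L * L * h z) ^ E ≤ ∏ is (λ i → (suc L * (k i z * M i z)) ^ e i)
      h-power z with h z ≟ℕ 0
      ... | yes h≡0 = ≤-trans (≤-reflexive (trans (cong (λ v → (L * L * v) ^ E) h≡0)
                        (trans (cong (_^ E) (*-zeroʳ (L * L))) (0^ 0<E)))) z≤n
      ... | no  h≢0 = ^-cancelˡ-≤ Δ 0<Δ (begin
          ((L * L * h z) ^ E) ^ Δ
            ≡⟨ trans (^-*-assoc (L * L * h z) E Δ) (^-distribʳ-* (E * Δ) (L * L) (h z)) ⟩
          (L * L) ^ (E * Δ) * h z ^ (E * Δ)
            ≡⟨ cong₂ _*_ (trans (cong ((L * L) ^_) (*-comm E Δ)) (sym (^-*-assoc (L * L) Δ E)))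
                 (trans (cong (h z ^_) (sym G+DΔ)) (^-distribˡ-+-* (h z) G (D * Δ))) ⟩
          ((L * L) ^ Δ) ^ E * (h z ^ G * h z ^ (D * Δ))
            ≤⟨ *-monoʳ-≤ (((L * L) ^ Δ) ^ E) (*-monoʳ-≤ (h z ^ G)
                 (≤-trans (≤-reflexive (sym (^-*-assoc (h z) D Δ))) (^-monoˡ-≤ Δ (h≤ z)))) ⟩
          ((L * L) ^ Δ) ^ E * (h z ^ G * ∏ is (λ i → M i z ^ e i) ^ Δ)
            ≡⟨ cong₂ _*_ (sym (∏-^∑ is _ e)) (cong₂ _*_ (sym (∏-^∑ is (h z) _)) (sym (∏-^ is _ Δ))) ⟩
          ∏ is (λ i → ((L * L) ^ Δ) ^ e i) * (∏ is (λ i → h z ^ ((Δ ∸ c i) * e i)) * ∏ is (λ i → (M i z ^ e i) ^ Δ))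
            ≡⟨ trans (cong (∏ is (λ i → ((L * L) ^ Δ) ^ e i) *_) (sym (∏-* is _ _))) (sym (∏-* is _ _)) ⟩
          ∏ is (λ i → ((L * L) ^ Δ) ^ e i * (h z ^ ((Δ ∸ c i) * e i) * (M i z ^ e i) ^ Δ))
            ≤⟨ ∏-mono is factor ⟩
          ∏ is (λ i → ((suc L * (k i z * M i z)) ^ e i) ^ Δ)
            ≡⟨ ∏-^ is _ Δ ⟩
          ∏ is (λ i → (suc L * (k i z * M i z)) ^ e i) ^ Δ ∎)
        where
        open ≤-Reasoning
        factor : ∀ i → ((L * L) ^ Δ) ^ e i * (h z ^ ((Δ ∸ c i) * e i) * (M i z ^ e i) ^ Δ) ≤
                       ((suc L * (k i z * M i z)) ^ e i) ^ Δ
        factor i = begin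
          l ^ ε * (h z ^ ((Δ ∸ c i) * ε) * (M i z ^ ε) ^ Δ)
            ≡⟨ cong₂ (λ u v → l ^ ε * (u * v)) (sym (^-*-assoc (h z) (Δ ∸ c i) ε)) (^-comm (M i z) ε Δ) ⟩
          l ^ ε * (H ^ ε * (M i z ^ Δ) ^ ε)
            ≡⟨ trans (sym (*-assoc (l ^ ε) (H ^ ε) _)) (trans (cong (_* (M i z ^ Δ) ^ ε) (sym (^-distribʳ-* ε l H)))
                 (sym (^-distribʳ-* ε (l * H) _))) ⟩
          (l * H * M i z ^ Δ) ^ ε
            ≤⟨ ^-monoˡ-≤ ε (*-monoˡ-≤ (M i z ^ Δ) (k-lower i z (n≢0⇒n>0 h≢0))) ⟩
          ((suc L * k i z) ^ Δ * M i z ^ Δ) ^ ε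
            ≡⟨ cong (_^ ε) (trans (sym (^-distribʳ-* Δ (suc L * k i z) (M i z))) (cong (_^ Δ) (*-assoc (suc L) (k i z) (M i z)))) ⟩
          ((suc L * (k i z * M i z)) ^ Δ) ^ ε
            ≡⟨ ^-comm (suc L * (k i z * M i z)) Δ ε ⟩
          ((suc L * (k i z * M i z)) ^ ε) ^ Δ ∎
          where
          l = (L * L) ^ Δ
          H = h z ^ (Δ ∸ c i)
          ε = e i

      P : I → ℕ
      P i = ∑ zs (λ z → ω z * k i z * M i z)

      S-power : (L * L * S) ^ E ≤ ∏ is (λ i → (suc L * P i) ^ e i)
      S-power = subst₂ (λ u v → u ^ E ≤ v) (∑-*ˡ zs (L * L) _)
          (trans (*-identityˡ _) (∏-cong is (λ i → cong (_^ e i) (∑-*ˡ zs (suc L) _))))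
          (hölder zs is e 0<E (λ z → L * L * (ω z * h z)) (λ i z → suc L * (ω z * k i z * M i z)) 1
            (λ z → subst ((L * L * (ω z * h z)) ^ E ≤_) (sym (*-identityˡ _)) (weighted z)))
        where
        open ≤-Reasoning
        e₁ : ∀ l w h → l * (w * h) ≡ w * (l * h)
        e₁ = solve-∀
        e₂ : ∀ w l k m → w * (l * (k * m)) ≡ l * (w * k * m)
        e₂ = solve-∀
        weighted : ∀ z → (L * L * (ω z * h z)) ^ E ≤ ∏ is (λ i → (suc L * (ω z * k i z * M i z)) ^ e i)
        weighted z = begin
          (L * L * (ω z * h z)) ^ E
            ≡⟨ trans (cong (_^ E) (e₁ (L * L) (ω z) (h z))) (^-distribʳ-* E (ω z) _) ⟩
          ω z ^ E * (L * L * h z) ^ E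
            ≤⟨ *-monoʳ-≤ (ω z ^ E) (h-power z) ⟩
          ω z ^ E * ∏ is (λ i → (suc L * (k i z * M i z)) ^ e i)
            ≡⟨ trans (cong (_* ∏ is (λ i → (suc L * (k i z * M i z)) ^ e i)) (sym (∏-^∑ is (ω z) e))) (sym (∏-* is _ _)) ⟩
          ∏ is (λ i → ω z ^ e i * (suc L * (k i z * M i z)) ^ e i)
            ≡⟨ ∏-cong is (λ i → trans (sym (^-distribʳ-* (e i) (ω z) _)) (cong (_^ e i) (e₂ (ω z) (suc L) (k i z) (M i z)))) ⟩
          ∏ is (λ i → (suc L * (ω z * k i z * M i z)) ^ e i) ∎

      N : ℕ
      N = E * (Δ * T)

      -- Once the bounds are inserted, S stands on both sides; cancelling S^(G T), possible for S >
      -- 0, leaves the power D Δ T. The quotient ((L + 1)/L)^N that remains is rounding error, with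
      -- N independent of L.
      scaled : 0 < S → L ^ N * S ^ (D * Δ * T) ≤ suc L ^ N * ∏ is β
      scaled 0<S = *-cancelʳ-≤ _ _ (L ^ N * S ^ (G * T))
          {{m*n≢0 _ _ {{m^n≢0 L N {{>-nonZero 0<L}}}} {{m^n≢0 S (G * T) {{>-nonZero 0<S}}}}}} (begin
          L ^ N * S ^ (D * Δ * T) * (L ^ N * S ^ (G * T))
            ≡⟨ e₁ (L ^ N) (S ^ (D * Δ * T)) (S ^ (G * T)) ⟩
          L ^ N * L ^ N * (S ^ (G * T) * S ^ (D * Δ * T))
            ≡⟨ cong₂ _*_ (sym (^-distribʳ-* N L L)) (trans (sym (^-distribˡ-+-* S (G * T) _)) (cong (S ^_) exponent)) ⟩
          (L * L) ^ N * S ^ N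
            ≡⟨ trans (sym (^-distribʳ-* N (L * L) S)) (sym (^-*-assoc (L * L * S) E (Δ * T))) ⟩
          ((L * L * S) ^ E) ^ (Δ * T)
            ≤⟨ ^-monoˡ-≤ (Δ * T) S-power ⟩
          ∏ is (λ i → (suc L * P i) ^ e i) ^ (Δ * T)
            ≡⟨ trans (sym (∏-^ is _ (Δ * T))) (∏-cong is (λ i → trans (^-*-assoc (suc L * P i) (e i) (Δ * T)) (^-distribʳ-* (e i * (Δ * T)) (suc L) (P i)))) ⟩
          ∏ is (λ i → suc L ^ (e i * (Δ * T)) * P i ^ (e i * (Δ * T)))
            ≤⟨ ∏-mono is (λ i → *-monoʳ-≤ (suc L ^ (e i * (Δ * T))) (bound i L (k i) (λ z → proj₁ (proj₂ (root i z))))) ⟩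
          ∏ is (λ i → suc L ^ (e i * (Δ * T)) * (L ^ (e i * (Δ * T)) * (S ^ ((Δ ∸ c i) * e i * T) * β i)))
            ≡⟨ trans (∏-* is _ _) (cong₂ _*_ (power (suc L)) (trans (∏-* is _ _) (cong₂ _*_ (power L)
                 (trans (∏-* is _ _) (cong (_* ∏ is β) (trans (∏-^∑ is S _) (cong (S ^_) (∑-*ʳ is T _)))))))) ⟩
          suc L ^ N * (L ^ N * (S ^ (G * T) * ∏ is β))
            ≡⟨ e₂ (suc L ^ N) (L ^ N) (S ^ (G * T)) (∏ is β) ⟩
          suc L ^ N * ∏ is β * (L ^ N * S ^ (G * T)) ∎)
        where
        open ≤-Reasoning
        e₁ : ∀ l s t → l * s * (l * t) ≡ l * l * (t * s)
        e₁ = solve-∀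
        e₂ : ∀ l k s b → l * (k * (s * b)) ≡ l * b * (k * s)
        e₂ = solve-∀
        power : ∀ x → ∏ is (λ i → x ^ (e i * (Δ * T))) ≡ x ^ N
        power x = trans (∏-^∑ is x _) (cong (x ^_) (∑-*ʳ is (Δ * T) e))
        exponent : G * T + D * Δ * T ≡ N
        exponent = trans (sym (*-distribʳ-+ T G (D * Δ))) (trans (cong (_* T) G+DΔ) (*-assoc E Δ T))

  ∑-bound : S ^ (D * Δ * T) ≤ ∏ is β
  ∑-bound with S ≟ℕ 0
  ... | yes S≡0 = ≤-trans (≤-reflexive (trans (cong (_^ (D * Δ * T)) S≡0) (0^ (*-mono-≤ (*-mono-≤ 0<D 0<Δ) 0<T)))) z≤n
  ... | no  S≢0 = ≤-limit (E * (Δ * T)) (λ L 0<L → Scale.scaled L 0<L (n≢0⇒n>0 S≢0))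

-- Isolating a vertex

⟦_⟧ : Bool → ℕ
⟦ true ⟧  = 1
⟦ false ⟧ = 0

infixl 5 _when_
_when_ : ℕ → Bool → ℕ
x when b = if b then x else 1

_==_ : ∀ {n} → Fin n → Fin n → Bool
u == v = does (u ≟ v)

==-refl : ∀ {n} (u : Fin n) → (u == u) ≡ true
==-refl u = dec-true (u ≟ u) refl

==-≢ : ∀ {n} {u v : Fin n} → u ≢ v → (u == v) ≡ false
==-≢ {u = u} {v} u≢v = dec-false (u ≟ v) u≢v

when-∧ : ∀ x b c → (x when b ∧ c) ≡ (x when b when c)
when-∧ x true  true  = refl
when-∧ x true  false = refl
when-∧ x false true  = refl
when-∧ x false false = refl

when-split : ∀ x y b → (if b then x else y) ≡ (x when b) * (y when not b)
when-split x y true  = sym (*-identityʳ x)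
when-split x y false = sym (*-identityˡ y)

∑-allFin-suc : ∀ {n} (f : Fin (suc n) → ℕ) →
               ∑ (allFin (suc n)) f ≡ f Fin.zero + ∑ (allFin n) (λ u → f (Fin.suc u))
∑-allFin-suc {n} f = trans (cong (λ us → ∑ us f) (allFin-suc n)) (cong (f Fin.zero +_) (∑-map Fin.suc (allFin n) f))

∑-at : ∀ {n} (w : Fin n) (f : Fin n → ℕ) → ∑ (allFin n) (λ u → ⟦ u == w ⟧ * f u) ≡ f w
∑-at {suc n} Fin.zero    f = trans (∑-allFin-suc (λ u → ⟦ u == Fin.zero ⟧ * f u))
  (trans (cong (f Fin.zero + 0 +_) (∑-zero (allFin n))) (trans (+-identityʳ _) (+-identityʳ _)))
∑-at {suc n} (Fin.suc w) f = trans (∑-allFin-suc (λ u → ⟦ u == Fin.suc w ⟧ * f u)) (∑-at w (λ u → f (Fin.suc u)))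

∏-at : ∀ {n} (w : Fin n) (f : Fin n → ℕ) → ∏ (allFin n) (λ u → f u when u == w) ≡ f w
∏-at {suc n} Fin.zero    f = trans (∏-allFin-suc (λ u → f u when u == Fin.zero)) (trans (cong (f Fin.zero *_) (∏-one (allFin n))) (*-identityʳ _))
∏-at {suc n} (Fin.suc w) f = trans (∏-allFin-suc (λ u → f u when u == Fin.suc w)) (trans (*-identityˡ _) (∏-at w (λ u → f (Fin.suc u))))

term-≤-∑ : ∀ {n} (w : Fin n) (f : Fin n → ℕ) → f w ≤ ∑ (allFin n) f
term-≤-∑ {n} w f = ≤-trans (≤-reflexive (sym (∑-at w f)))
  (∑-mono (allFin n) (λ u → ≤-trans (*-monoˡ-≤ (f u) (⟦⟧≤1 (u == w))) (≤-reflexive (*-identityˡ (f u)))))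
  where
  ⟦⟧≤1 : ∀ b → ⟦ b ⟧ ≤ 1
  ⟦⟧≤1 true  = ≤-refl
  ⟦⟧≤1 false = z≤n

∏-remove : ∀ {n} (w : Fin n) (f : Fin n → ℕ) →
           f w * ∏ (allFin n) (λ u → f u when not (u == w)) ≡ ∏ (allFin n) f
∏-remove {n} w f = trans (cong (_* ∏ (allFin n) (λ u → f u when not (u == w))) (sym (∏-at w f)))
  (trans (sym (∏-* (allFin n) _ _)) (∏-cong (allFin n) (λ u → eq (f u) (u == w))))
  where
  eq : ∀ x b → (x when b) * (x when not b) ≡ x
  eq x true  = *-identityʳ x
  eq x false = *-identityˡ x

-- The pair (w, w) lies in both the row and the column of w; the value 1 there makes the double
-- counting harmless.
∏-cross : ∀ {n} (w : Fin n) (f : Fin n → Fin n → ℕ) → f w w ≡ 1 →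
  ∏ (allFin n) (λ u → ∏ (allFin n) (λ v → f u v)) ≡
  ∏ (allFin n) (λ u → ∏ (allFin n) (λ v → f u v when not (v == w) when not (u == w))) *
    (∏ (allFin n) (λ u → f u w) * ∏ (allFin n) (λ v → f w v))
∏-cross {n} w f fww = begin
    ∏ vs (λ u → ∏ vs (f u))
      ≡⟨ ∏-cong vs (λ u → ∏-cong vs (λ v → entry u v)) ⟩
    ∏ vs (λ u → ∏ vs (λ v → rest u v * ((f u v when v == w) * (f u v when u == w))))
      ≡⟨ trans (∏-cong vs (λ u → trans (∏-* vs _ _) (cong (∏ vs (rest u) *_) (∏-* vs _ _))))
           (trans (∏-* vs _ _) (cong (∏ vs (λ u → ∏ vs (rest u)) *_) (∏-* vs _ _))) ⟩
    ∏ vs (λ u → ∏ vs (rest u)) *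
      (∏ vs (λ u → ∏ vs (λ v → f u v when v == w)) * ∏ vs (λ u → ∏ vs (λ v → f u v when u == w)))
      ≡⟨ cong (∏ vs (λ u → ∏ vs (rest u)) *_) (cong₂ _*_
           (∏-cong vs (λ u → ∏-at w (f u)))
           (trans (∏-swap vs vs _) (∏-cong vs (λ v → ∏-at w (λ u → f u v))))) ⟩
    ∏ vs (λ u → ∏ vs (rest u)) * (∏ vs (λ u → f u w) * ∏ vs (f w)) ∎
  where
  open ≡-Reasoning
  vs = allFin n
  rest : Fin n → Fin n → ℕ
  rest u v = f u v when not (v == w) when not (u == w)
  entry : ∀ u v → f u v ≡ rest u v * ((f u v when v == w) * (f u v when u == w))
  entry u v with u ≟ w | v ≟ w
  ... | yes refl | yes refl = trans fww (cong (λ y → 1 * (y * y)) (sym fww))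
  ... | yes _    | no  _    = sym (trans (*-identityˡ _) (*-identityˡ _))
  ... | no  _    | yes _    = sym (trans (*-identityˡ _) (*-identityʳ _))
  ... | no  _    | no  _    = sym (*-identityʳ _)

-- For degrees, this separates the edgeless base case from the choice of the vertex for the
-- induction step.
max-or-zero : ∀ {n} (f : Fin n → ℕ) → (∀ u → f u ≡ 0) ⊎ ∃ λ w → 0 < f w × (∀ u → f u ≤ f w)
max-or-zero {zero}  f = inj₁ λ ()
max-or-zero {suc n} f with max-or-zero (λ u → f (Fin.suc u))
... | inj₁ f≡0 = head (f Fin.zero) refl
  where
  head : ∀ k → f Fin.zero ≡ k → (∀ u → f u ≡ 0) ⊎ ∃ λ w → 0 < f w × (∀ u → f u ≤ f w)
  head zero    f0≡ = inj₁ λ { Fin.zero → f0≡ ; (Fin.suc u) → f≡0 u }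
  head (suc k) f0≡ = inj₂ (Fin.zero , subst (0 <_) (sym f0≡) z<s ,
    λ { Fin.zero → ≤-refl ; (Fin.suc u) → ≤-trans (≤-reflexive (f≡0 u)) z≤n })
... | inj₂ (w , 0<fw , f≤) with ≤-total (f Fin.zero) (f (Fin.suc w))
...   | inj₁ f0≤ = inj₂ (Fin.suc w , 0<fw , λ { Fin.zero → f0≤ ; (Fin.suc u) → f≤ u })
...   | inj₂ ≤f0 = inj₂ (Fin.zero , <-≤-trans 0<fw ≤f0 , λ { Fin.zero → ≤-refl ; (Fin.suc u) → ≤-trans (f≤ u) ≤f0 })

module _ {n : ℕ} where

  open SimpleGraph renaming (sym to adj-sym)

  vs : List (Fin n)
  vs = allFin n

  deg : SimpleGraph n → Fin n → ℕ
  deg G u = ∑ vs (λ v → ⟦ adj G u v ⟧)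

  adj⇒deg>0 : ∀ (G : SimpleGraph n) {u v} → adj G u v ≡ true → 0 < deg G u
  adj⇒deg>0 G {u} {v} uv = ≤-trans (≤-reflexive (cong ⟦_⟧ (sym uv))) (term-≤-∑ v (λ v → ⟦ adj G u v ⟧))

  deg≤n : ∀ (G : SimpleGraph n) u → deg G u ≤ n
  deg≤n G u = ≤-trans (∑-mono vs (λ v → ⟦⟧≤1 (adj G u v))) (≤-reflexive (trans (count vs) (length-tabulate id)))
    where
    ⟦⟧≤1 : ∀ b → ⟦ b ⟧ ≤ 1
    ⟦⟧≤1 true  = ≤-refl
    ⟦⟧≤1 false = z≤n
    count : (us : List (Fin n)) → ∑ us (λ _ → 1) ≡ length us
    count []       = refl
    count (_ ∷ us) = cong suc (count us)

  -- w is kept as an isolated vertex, so that the vertex set is the same throughout the induction.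
  isolate : Fin n → SimpleGraph n → SimpleGraph n
  isolate w G .adj u v = (adj G u v ∧ not (v == w)) ∧ not (u == w)
  isolate w G .adj-sym u v = trans (cong (λ b → (b ∧ not (v == w)) ∧ not (u == w)) (adj-sym G u v))
    (∧-swap (adj G v u) (not (v == w)) (not (u == w)))
    where
    ∧-swap : ∀ x y z → (x ∧ y) ∧ z ≡ (x ∧ z) ∧ y
    ∧-swap true  true  true  = refl
    ∧-swap true  true  false = refl
    ∧-swap true  false true  = refl
    ∧-swap true  false false = refl
    ∧-swap false y     z     = refl
  isolate w G .irrefl u = cong (λ b → (b ∧ not (u == w)) ∧ not (u == w)) (irrefl G u)

  module _ (w : Fin n) (G : SimpleGraph n) where

    isolate⊆ : ∀ {u v} → adj (isolate w G) u v ≡ true → adj G u v ≡ true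
    isolate⊆ e = ∧-conicalˡ _ _ (∧-conicalˡ _ _ e)

    isolate-avoidsˡ : ∀ {u v} → adj (isolate w G) u v ≡ true → u ≢ w
    isolate-avoidsˡ {u} {v} e refl with adj G u v ∧ not (v == w) | ==-refl u
    isolate-avoidsˡ {u} {v} e refl | true  | q = contradiction (trans (sym (cong not q)) e) λ ()
    isolate-avoidsˡ {u} {v} () refl | false | q

    isolate-avoidsʳ : ∀ {u v} → adj (isolate w G) u v ≡ true → v ≢ w
    isolate-avoidsʳ {u} {v} e = isolate-avoidsˡ (trans (adj-sym (isolate w G) v u) e)

    isolate-triangleFree : TriangleFree G → TriangleFree (isolate w G)
    isolate-triangleFree tf u v x uv vx ux = tf u v x (isolate⊆ uv) (isolate⊆ vx) (isolate⊆ ux)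

    isolate-at : ∀ v → adj (isolate w G) w v ≡ false
    isolate-at v rewrite ==-refl w with adj G w v ∧ not (v == w)
    ... | true  = refl
    ... | false = refl

    deg-isolated : deg (isolate w G) w ≡ 0
    deg-isolated = trans (∑-cong vs (λ v → cong ⟦_⟧ (isolate-at v))) (∑-zero vs)

    deg-isolate : ∀ {u} → u ≢ w → deg G u ≡ ⟦ adj G u w ⟧ + deg (isolate w G) u
    deg-isolate {u} u≢w = trans (∑-cong vs entry)
      (trans (∑-+ vs _ _) (cong (_+ deg (isolate w G) u) (∑-at w (λ v → ⟦ adj G u v ⟧))))
      where
      entry : ∀ v → ⟦ adj G u v ⟧ ≡ ⟦ v == w ⟧ * ⟦ adj G u v ⟧ + ⟦ adj (isolate w G) u v ⟧
      entry v rewrite ==-≢ u≢w with v ≟ w | adj G u v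
      ... | yes _ | true  = refl
      ... | yes _ | false = refl
      ... | no  _ | true  = refl
      ... | no  _ | false = refl

    deg-isolate-≤ : ∀ u → deg (isolate w G) u ≤ deg G u
    deg-isolate-≤ u = cases (u ≟ w)
      where
      cases : Dec (u ≡ w) → deg (isolate w G) u ≤ deg G u
      cases (yes refl) = ≤-trans (≤-reflexive deg-isolated) z≤n
      cases (no  u≢w)  = ≤-trans (m≤n+m _ ⟦ adj G u w ⟧) (≤-reflexive (sym (deg-isolate u≢w)))

    -- The decrease of the measure on which the induction runs.
    ∑-deg-isolate : 0 < deg G w → ∑ vs (deg (isolate w G)) < ∑ vs (deg G)
    ∑-deg-isolate 0<dw = begin
        suc (∑ vs (deg (isolate w G)))
          ≡⟨ +-comm 1 _ ⟩
        ∑ vs (deg (isolate w G)) + 1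
          ≤⟨ +-monoʳ-≤ (∑ vs (deg (isolate w G))) (≤-trans 0<dw (≤-reflexive (sym (∑-at w (deg G))))) ⟩
        ∑ vs (deg (isolate w G)) + ∑ vs (λ u → ⟦ u == w ⟧ * deg G u)
          ≡⟨ sym (∑-+ vs _ _) ⟩
        ∑ vs (λ u → deg (isolate w G) u + ⟦ u == w ⟧ * deg G u)
          ≤⟨ ∑-mono vs entry ⟩
        ∑ vs (deg G) ∎
      where
      open ≤-Reasoning
      entry : ∀ u → deg (isolate w G) u + ⟦ u == w ⟧ * deg G u ≤ deg G u
      entry u = cases (u ≟ w)
        where
        cases : (p : Dec (u ≡ w)) → deg (isolate w G) u + ⟦ does p ⟧ * deg G u ≤ deg G u
        cases (yes refl) = ≤-reflexive (trans (cong (_+ (deg G u + 0)) deg-isolated) (+-identityʳ (deg G u)))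
        cases (no  _)    = ≤-trans (≤-reflexive (+-identityʳ _)) (deg-isolate-≤ u)

-- Weighted homomorphisms conditioned on the colour of a vertex

module Colouring {m : ℕ} (a : Fin m → Fin m → ℕ) (a-sym : ∀ x y → a x y ≡ a y x)
                 (a-idem : ∀ x y → a x y * a x y ≡ a x y) where

  open Biclique a a-sym public

  module _ {n : ℕ} where

    open SimpleGraph renaming (sym to adj-sym)

    -- Both orientations of an edge contribute a factor; by `a-idem` this amounts to one factor.
    edges : SimpleGraph n → (Fin n → Fin m) → ℕ
    edges G φ = ∏ vs (λ u → ∏ vs (λ v → a (φ u) (φ v) when adj G u v))

    weightedHom : SimpleGraph n → (Fin n → Fin m → ℕ) → ℕ
    weightedHom G α = ∑ (allMaps n m) (λ φ → ∏ vs (λ u → α u (φ u)) * edges G φ)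

    -- When w is coloured z, the factors a z of its edges are absorbed by the weights of its neighbours.
    condition : Fin n → SimpleGraph n → (Fin n → Fin m → ℕ) → Fin m → Fin n → Fin m → ℕ
    condition w G α z u x = (if u == w then ⟦ x == z ⟧ else α u x) * (a z x when adj G u w)

    module _ (w : Fin n) (G : SimpleGraph n) where

      edges-isolate : ∀ φ → edges G φ ≡ edges (isolate w G) φ * ∏ vs (λ u → a (φ w) (φ u) when adj G u w)
      edges-isolate φ = trans (∏-cross w f fww) (cong₂ _*_
          (∏-cong vs (λ u → ∏-cong vs (λ v → sym (trans (when-∧ _ (adj G u v ∧ not (v == w)) (not (u == w)))
            (cong (_when not (u == w)) (when-∧ _ (adj G u v) (not (v == w))))))))
          (trans (cong₂ _*_ (∏-cong vs (λ u → cong (_when adj G u w) (a-sym (φ u) (φ w))))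
                            (∏-cong vs (λ v → cong (a (φ w) (φ v) when_) (adj-sym G w v))))
            (trans (sym (∏-* (allFin n) _ _)) (∏-cong vs (λ u → when-idem (a-idem (φ w) (φ u)) (adj G u w))))))
        where
        f : Fin n → Fin n → ℕ
        f u v = a (φ u) (φ v) when adj G u v
        fww : f w w ≡ 1
        fww = cong (a (φ w) (φ w) when_) (irrefl G w)
        when-idem : ∀ {x} → x * x ≡ x → ∀ b → (x when b) * (x when b) ≡ (x when b)
        when-idem x² true  = x²
        when-idem x² false = refl

      -- The isolated w keeps an indicator weight, which selects the colourings with φ w = z; its
      -- original weight stands in front.
      weightedHom-condition : ∀ α → weightedHom G α ≡ ∑ (allFin m) (λ z → α w z * weightedHom (isolate w G) (condition w G α z))
      weightedHom-condition α = sym (begin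
          ∑ zs (λ z → α w z * weightedHom G′ (condition w G α z))
            ≡⟨ ∑-cong zs (λ z → sym (∑-*ˡ (allMaps n m) (α w z) _)) ⟩
          ∑ zs (λ z → ∑ (allMaps n m) (λ φ → α w z * (∏ vs (λ u → condition w G α z u (φ u)) * edges G′ φ)))
            ≡⟨ ∑-swap zs (allMaps n m) _ ⟩
          ∑ (allMaps n m) (λ φ → ∑ zs (λ z → α w z * (∏ vs (λ u → condition w G α z u (φ u)) * edges G′ φ)))
            ≡⟨ ∑-cong (allMaps n m) (λ φ → trans (∑-cong zs (λ z → summand φ z)) (∑-at (φ w) _)) ⟩
          ∑ (allMaps n m) (λ φ → α w (φ w) * B φ * (C φ (φ w) * edges G′ φ))
            ≡⟨ ∑-cong (allMaps n m) (λ φ → cong₂ _*_ (∏-remove w (λ u → α u (φ u)))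
                 (trans (*-comm (C φ (φ w)) _) (sym (edges-isolate φ)))) ⟩
          weightedHom G α ∎)
        where
        open ≡-Reasoning
        zs = allFin m
        G′ = isolate w G
        B : (Fin n → Fin m) → ℕ
        B φ = ∏ vs (λ u → α u (φ u) when not (u == w))
        C : (Fin n → Fin m) → Fin m → ℕ
        C φ z = ∏ vs (λ u → a z (φ u) when adj G u w)
        ==-sym : ∀ (x y : Fin m) → (x == y) ≡ (y == x)
        ==-sym x y with x ≟ y
        ... | yes refl = sym (==-refl x)
        ... | no  x≢y  = sym (==-≢ (λ y≡x → x≢y (sym y≡x)))
        e₁ : ∀ x i b c e → x * (i * b * c * e) ≡ i * (x * b * (c * e))
        e₁ = solve-∀
        summand : ∀ φ z → α w z * (∏ vs (λ u → condition w G α z u (φ u)) * edges G′ φ)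
                          ≡ ⟦ z == φ w ⟧ * (α w z * B φ * (C φ z * edges G′ φ))
        summand φ z = trans (cong (λ v → α w z * (v * edges G′ φ)) factor)
            (e₁ (α w z) ⟦ z == φ w ⟧ (B φ) (C φ z) (edges G′ φ))
          where
          factor : ∏ vs (λ u → condition w G α z u (φ u)) ≡ ⟦ z == φ w ⟧ * B φ * C φ z
          factor = trans (∏-* (allFin n) _ _) (cong (_* C φ z) (trans
            (∏-cong vs (λ u → when-split ⟦ φ u == z ⟧ (α u (φ u)) (u == w)))
            (trans (∏-* (allFin n) _ _) (cong (_* B φ)
              (trans (∏-at w (λ u → ⟦ φ u == z ⟧)) (cong ⟦_⟧ (==-sym (φ w) z)))))))

      condition-at : ∀ α z x → condition w G α z w x ≡ ⟦ x == z ⟧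
      condition-at α z x rewrite ==-refl w | irrefl G w = *-identityʳ _

      condition-neighbour : ∀ α z {u} → adj G u w ≡ true → ∀ x → condition w G α z u x ≡ α u x * a z x
      condition-neighbour α z {u} uw x = cong₂ (λ b c → (if b then ⟦ x == z ⟧ else α u x) * (a z x when c))
        (==-≢ (λ u≡w → contradiction (trans (sym uw) (trans (cong (λ v → adj G v w) u≡w) (irrefl G w))) λ ())) uw

      condition-other : ∀ α z {u} → u ≢ w → adj G u w ≡ false → ∀ x → condition w G α z u x ≡ α u x
      condition-other α z {u} u≢w uw x = trans
        (cong₂ (λ b c → (if b then ⟦ x == z ⟧ else α u x) * (a z x when c)) (==-≢ u≢w) uw) (*-identityʳ _)

-- The inequality for irregular weighted graphs

isZero : ℕ → ℕ
isZero zero    = 1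
isZero (suc _) = 0

isZero-pos : ∀ {d} → 0 < d → isZero d ≡ 0
isZero-pos (s≤s _) = refl

module Potential {m : ℕ} (a : Fin m → Fin m → ℕ) (a-sym : ∀ x y → a x y ≡ a y x)
                 (a-idem : ∀ x y → a x y * a x y ≡ a x y)
                 (n T : ℕ) (0<T : 0 < T)
                 (quot-T : ∀ c → 0 < c → c ≤ n → quot T c * c ≡ T) where

  open Colouring a a-sym a-idem public
  open SimpleGraph renaming (sym to adj-sym)

  Weights : Set
  Weights = Fin n → Fin m → ℕ

  zs : List (Fin m)
  zs = allFin m

  us : List (Fin n)
  us = allFin n

  q : ℕ → ℕ
  q = quot T

  D : ℕ
  D = 2 * (T * T)

  vertexExp : SimpleGraph n → Fin n → ℕ
  vertexExp G u = isZero (deg G u) * D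

  pairExp : SimpleGraph n → Fin n → Fin n → ℕ
  pairExp G u v = ⟦ adj G u v ⟧ * (q (deg G u) * q (deg G v))

  -- In this biclique a vertex of weight `α u` has degree `deg G u`, as u has in G; hence there are
  -- `deg G v` of them.
  pairW : SimpleGraph n → Weights → Fin n → Fin n → ℕ
  pairW G α u v = W (α u) (α v) (deg G v) (deg G u)

  -- The D-th power of ∏ (∑ α u) over isolated u times ∏ hom(K_{deg v, deg u})^(1/(deg u · deg v)) over
  -- edges uv; D = 2T² counts every edge in both directions.
  Ψ : SimpleGraph n → Weights → ℕ
  Ψ G α = ∏ us (λ u → ∑ zs (α u) ^ vertexExp G u) * ∏ us (λ u → ∏ us (λ v → pairW G α u v ^ pairExp G u v))

  pairW-sym : ∀ G α u v → pairW G α u v ≡ pairW G α v u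
  pairW-sym G α u v = W-sym (α u) (α v) (deg G v) (deg G u)

  -- All factors of Ψ form one family, so that a single use of `Duality` covers them; the exponent 0
  -- switches off the absent ones.
  Index : Set
  Index = Fin n ⊎ (Fin n × Fin n)

  indices : List Index
  indices = map inj₁ us ++ concatMap (λ u → map (λ v → inj₂ (u , v)) us) us

  ∏-indices : ∀ f → ∏ indices f ≡ ∏ us (λ u → f (inj₁ u)) * ∏ us (λ u → ∏ us (λ v → f (inj₂ (u , v))))
  ∏-indices f = trans (∏-++ (map inj₁ us) _ f) (cong₂ _*_ (∏-map inj₁ us f)
    (trans (∏-concatMap _ us f) (∏-cong us (λ u → ∏-map (λ v → inj₂ (u , v)) us f))))

  ∑-indices : ∀ f → ∑ indices f ≡ ∑ us (λ u → f (inj₁ u)) + ∑ us (λ u → ∑ us (λ v → f (inj₂ (u , v))))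
  ∑-indices f = trans (∑-++ (map inj₁ us) _ f) (cong₂ _+_ (∑-map inj₁ us f)
    (trans (∑-concatMap _ us f) (∑-cong us (λ u → ∑-map (λ v → inj₂ (u , v)) us f))))

  -- The induction step at a vertex of maximum degree

  module Step (G : SimpleGraph n) (tf : TriangleFree G) (α : Weights) (w : Fin n)
              (0<Δ : 0 < deg G w) (deg≤Δ : ∀ u → deg G u ≤ deg G w) where

    Δ : ℕ
    Δ = deg G w

    G′ : SimpleGraph n
    G′ = isolate w G

    d d′ : Fin n → ℕ
    d = deg G
    d′ = deg G′

    α′ : Fin m → Weights
    α′ = condition w G α

    h : Fin m → ℕ
    h z = weightedHom G′ (α′ z)

    S : ℕ
    S = ∑ zs (λ z → α w z * h z)

    -- The biclique count of the edge uw, with the sides ordered as `W-tilted` delivers them.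
    R : Fin n → ℕ
    R u = W (α w) (α u) (d u) Δ

    d′≤Δ : ∀ u → d′ u ≤ Δ
    d′≤Δ u = ≤-trans (deg-isolate-≤ w G u) (deg≤Δ u)

    d-neighbour : ∀ {u} → adj G u w ≡ true → d u ≡ suc (d′ u)
    d-neighbour {u} uw = trans (deg-isolate w G u≢w) (cong (λ b → ⟦ b ⟧ + d′ u) uw)
      where
      u≢w : u ≢ w
      u≢w u≡w = contradiction (trans (sym uw) (trans (cong (λ v → adj G v w) u≡w) (irrefl G w))) λ ()

    d-other : ∀ {u} → u ≢ w → adj G u w ≡ false → d u ≡ d′ u
    d-other {u} u≢w uw = trans (deg-isolate w G u≢w) (cong (λ b → ⟦ b ⟧ + d′ u) uw)

    0<d′ : ∀ {u v} → adj G′ u v ≡ true → 0 < d′ u × 0 < d′ v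
    0<d′ {u} {v} uv = adj⇒deg>0 G′ uv , adj⇒deg>0 G′ (trans (adj-sym G′ v u) uv)

    q-d′ : ∀ {u} → 0 < d′ u → q (d′ u) * d′ u ≡ T
    q-d′ {u} 0<d = quot-T (d′ u) 0<d (deg≤n G′ u)

    -- `W-conditioned` lets the weights of only one side depend on z; this is what makes it
    -- applicable to every surviving edge.
    far : ∀ {u v} → adj G′ u v ≡ true → adj G u w ≡ true → adj G v w ≡ false
    far {u} {v} uv uw with adj G v w in vw
    ... | false = refl
    ... | true  = ⊥-elim (tf u v w (isolate⊆ w G uv) vw uw)

    -- Hypothesis `bound` of `Duality` for one factor. It stands for the estimate of the e Δ T-th
    -- power of the Δ/c-norm of M by β, tested only on functions k ≤ L h^((Δ - c)/Δ).
    Bound : (e c : ℕ) (M : Fin m → ℕ) (β : ℕ) → Set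
    Bound e c M β = ∀ L (k : Fin m → ℕ) → (∀ z → k z ^ Δ ≤ L ^ Δ * h z ^ (Δ ∸ c)) →
      ∑ zs (λ z → α w z * k z * M z) ^ (e * (Δ * T)) ≤ L ^ (e * (Δ * T)) * (S ^ ((Δ ∸ c) * e * T) * β)

    Bound-resp : ∀ {e e₁ c c₁ M M₁ β β₁} → e ≡ e₁ → c ≡ c₁ → (∀ z → M z ≡ M₁ z) → β ≡ β₁ →
                 Bound e c M β → Bound e₁ c₁ M₁ β₁
    Bound-resp {e} refl refl M≡ refl b L k k≤ =
      subst (λ P → P ^ (e * (Δ * T)) ≤ _) (∑-cong zs (λ z → cong (α w z * k z *_) (M≡ z))) (b L k k≤)

    bound-trivial : ∀ c M → Bound 0 c M 1
    bound-trivial c M L k k≤ = ≤-reflexive (sym (trans (*-identityˡ _)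
      (trans (*-identityʳ _) (cong (λ x → S ^ (x * T)) (*-zeroʳ (Δ ∸ c))))))

    -- Factors that do not feel z belong to c = 0, the supremum norm; there k ≤ L h.
    bound-constant : ∀ e C → Bound e 0 (λ _ → C) (C ^ (e * (Δ * T)))
    bound-constant e C L k k≤ = begin
        ∑ zs (λ z → α w z * k z * C) ^ p
          ≤⟨ ^-monoˡ-≤ p (∑-mono zs (λ z → *-monoˡ-≤ C (*-monoʳ-≤ (α w z) (k≤Lh z)))) ⟩
        ∑ zs (λ z → α w z * (L * h z) * C) ^ p
          ≡⟨ cong (_^ p) (trans (∑-cong zs (λ z → e₁ (α w z) L (h z) C)) (∑-*ˡ zs (L * C) _)) ⟩
        (L * C * S) ^ p
          ≡⟨ trans (^-distribʳ-* p (L * C) S) (cong (_* S ^ p) (^-distribʳ-* p L C)) ⟩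
        L ^ p * C ^ p * S ^ p
          ≡⟨ e₂ (L ^ p) (C ^ p) (S ^ p) ⟩
        L ^ p * (S ^ p * C ^ p)
          ≡⟨ cong (λ x → L ^ p * (S ^ x * C ^ p)) (e₃ e Δ T) ⟩
        L ^ p * (S ^ (Δ * e * T) * C ^ p) ∎
      where
      open ≤-Reasoning
      p = e * (Δ * T)
      e₁ : ∀ w l h c → w * (l * h) * c ≡ l * c * (w * h)
      e₁ = solve-∀
      e₂ : ∀ l c s → l * c * s ≡ l * (s * c)
      e₂ = solve-∀
      e₃ : ∀ e Δ T → e * (Δ * T) ≡ Δ * e * T
      e₃ = solve-∀
      k≤Lh : ∀ z → k z ≤ L * h z
      k≤Lh z = ^-cancelˡ-≤ Δ 0<Δ (≤-trans (k≤ z) (≤-reflexive (sym (^-distribʳ-* Δ L (h z)))))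

    -- `W-conditioned` raised to the power q b * e; since q b * b = T, this turns the exponent b Δ
    -- into e Δ T. Here b′ and b = b′ + 1 are the degrees of a neighbour of w after and before the
    -- deletion.
    bound-neighbour : ∀ e c b′ β γ → c ≤ Δ → q (suc b′) * suc b′ ≡ T →
      Bound e c (λ z → W (λ x → β x * a z x) γ c b′)
        (W β γ c (suc b′) ^ (b′ * Δ * (q (suc b′) * e)) * W (α w) β (suc b′) Δ ^ (c * (q (suc b′) * e)))
    bound-neighbour e c b′ β γ c≤Δ qb≡T L k k≤ = begin
        P ^ (e * (Δ * T))
          ≡⟨ cong (P ^_) (expand e Δ) ⟩
        P ^ (b * Δ * s)
          ≡⟨ sym (^-*-assoc P (b * Δ) s) ⟩
        (P ^ (b * Δ)) ^ s
          ≤⟨ ^-monoˡ-≤ s core ⟩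
        (W β γ c b ^ (b′ * Δ) * (L ^ (b * Δ) * (S ^ (b * r) * W (α w) β b Δ ^ c))) ^ s
          ≡⟨ trans (^-distribʳ-* s (W β γ c b ^ (b′ * Δ)) _) (cong₂ _*_ (^-*-assoc (W β γ c b) (b′ * Δ) s)
               (trans (^-distribʳ-* s (L ^ (b * Δ)) _) (cong₂ _*_ (^-*-assoc L (b * Δ) s)
                 (trans (^-distribʳ-* s (S ^ (b * r)) _) (cong₂ _*_ (^-*-assoc S (b * r) s) (^-*-assoc (W (α w) β b Δ) c s)))))) ⟩
        W β γ c b ^ (b′ * Δ * s) * (L ^ (b * Δ * s) * (S ^ (b * r * s) * W (α w) β b Δ ^ (c * s)))
          ≡⟨ cong₂ (λ x y → W β γ c b ^ (b′ * Δ * s) * (L ^ x * (S ^ y * W (α w) β b Δ ^ (c * s))))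
               (sym (expand e Δ)) (trans (sym (expand e r)) (e₁ e r T)) ⟩
        W β γ c b ^ (b′ * Δ * s) * (L ^ (e * (Δ * T)) * (S ^ (r * e * T) * W (α w) β b Δ ^ (c * s)))
          ≡⟨ e₂ (W β γ c b ^ (b′ * Δ * s)) (L ^ (e * (Δ * T))) (S ^ (r * e * T)) _ ⟩
        _ ∎
      where
      open ≤-Reasoning
      b = suc b′
      r = Δ ∸ c
      s = q b * e
      P = ∑ zs (λ z → α w z * k z * W (λ x → β x * a z x) γ c b′)
      expand : ∀ e r → e * (r * T) ≡ b * r * (q b * e)
      expand e r = trans (cong (λ t → e * (r * t)) (sym qb≡T)) (eq e r (q b) b)
        where eq : ∀ e r q b → e * (r * (q * b)) ≡ b * r * (q * e)
              eq = solve-∀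
      e₁ : ∀ e r t → e * (r * t) ≡ r * e * t
      e₁ = solve-∀
      e₂ : ∀ w l s r → w * (l * (s * r)) ≡ l * (s * (w * r))
      e₂ = solve-∀
      core : P ^ (b * Δ) ≤ W β γ c b ^ (b′ * Δ) * (L ^ (b * Δ) * (S ^ (b * r) * W (α w) β b Δ ^ c))
      core = subst (λ x → P ^ (b * x) ≤ W β γ c b ^ (b′ * x) * (L ^ (b * x) * (S ^ (b * r) * W (α w) β b x ^ c)))
        (m∸n+n≡m c≤Δ)
        (W-conditioned (α w) β r c (subst (0 <_) (sym (m∸n+n≡m c≤Δ)) 0<Δ) k h L
          (λ z → subst (λ x → k z ^ x ≤ L ^ x * h z ^ r) (sym (m∸n+n≡m c≤Δ)) (k≤ z)) γ b′)

    -- How the exponent T² of the edge uw is shared among the terms of Ψ G′ that involve u: see row-sum.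
    r₁ : Fin n → ℕ
    r₁ u = ⟦ adj G u w ⟧ * (isZero (d′ u) * (T * T))

    r₂ : Fin n → Fin n → ℕ
    r₂ u v = ⟦ adj G u w ⟧ * (⟦ adj G′ u v ⟧ * (q (d′ u) * T))

    ρ₁ : Fin n → ℕ
    ρ₁ u = R u ^ (q (d u) * r₁ u)

    ρ₂ : Fin n → Fin n → ℕ
    ρ₂ u v = R u ^ (q (d u) * r₂ u v)

    old : Fin n → Fin n → ℕ
    old u v = (pairW G α u v ^ pairExp G u v) ^ (Δ * T)

    -- The part of Ψ G at pairs avoiding w; the pairs that contain w are rebuilt from `ρ₁` and `ρ₂`
    -- in `ρ-row`.
    X : Fin n → Fin n → ℕ
    X u v = old u v when not (v == w) when not (u == w)

    -- `c′` counts the vertices constrained by z: for a neighbour u of w, the biclique of the pair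
    -- (u, v) has d′ v vertices of weight `α′ z u`.
    e′ c′ : Index → ℕ
    e′ (inj₁ u)       = vertexExp G′ u
    e′ (inj₂ (u , v)) = pairExp G′ u v
    c′ (inj₁ u)       = ⟦ adj G u w ⟧
    c′ (inj₂ (u , v)) = if adj G u w then d′ v else if adj G v w then d′ u else 0

    M′ : Index → Fin m → ℕ
    M′ (inj₁ u)       z = ∑ zs (α′ z u)
    M′ (inj₂ (u , v)) z = pairW G′ (α′ z) u v

    -- Ψ contains both (u, w) and (w, u), so each share of uw must occur twice: squared at a vertex,
    -- and through the pairs (u, v) and (v, u) at an edge.
    β′ : Index → ℕ
    β′ (inj₁ u)       = (∑ zs (α u) ^ vertexExp G u) ^ (Δ * T) * (ρ₁ u * ρ₁ u)
    β′ (inj₂ (u , v)) = X u v * (ρ₂ u v * ρ₂ v u)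

    c′≤Δ : ∀ i → c′ i ≤ Δ
    c′≤Δ (inj₁ u) with adj G u w
    ... | true  = 0<Δ
    ... | false = z≤n
    c′≤Δ (inj₂ (u , v)) with adj G u w | adj G v w
    ... | true  | _     = d′≤Δ v
    ... | false | true  = d′≤Δ u
    ... | false | false = z≤n

    r₁-zero : ∀ {u} → adj G u w ≡ false → r₁ u ≡ 0
    r₁-zero {u} uw = cong (λ b → ⟦ b ⟧ * (isZero (d′ u) * (T * T))) uw

    r₂-zeroˡ : ∀ {u} v → adj G u w ≡ false → r₂ u v ≡ 0
    r₂-zeroˡ {u} v uw = cong (λ b → ⟦ b ⟧ * (⟦ adj G′ u v ⟧ * (q (d′ u) * T))) uw

    r₂-zeroʳ : ∀ {u v} → adj G′ u v ≡ false → r₂ u v ≡ 0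
    r₂-zeroʳ {u} {v} uv = trans (cong (λ b → ⟦ adj G u w ⟧ * (⟦ b ⟧ * (q (d′ u) * T))) uv) (*-zeroʳ ⟦ adj G u w ⟧)

    r₂-on : ∀ {u v} → adj G u w ≡ true → adj G′ u v ≡ true → r₂ u v ≡ q (d′ u) * T
    r₂-on {u} {v} uw uv = trans (cong₂ (λ b c → ⟦ b ⟧ * (⟦ c ⟧ * (q (d′ u) * T))) uw uv)
      (trans (+-identityʳ _) (+-identityʳ _))

    ρ₁-one : ∀ {u} → r₁ u ≡ 0 → ρ₁ u ≡ 1
    ρ₁-one {u} r≡0 = cong (R u ^_) (trans (cong (q (d u) *_) r≡0) (*-zeroʳ (q (d u))))

    ρ₂-one : ∀ {u v} → r₂ u v ≡ 0 → ρ₂ u v ≡ 1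
    ρ₂-one {u} r≡0 = cong (R u ^_) (trans (cong (q (d u) *_) r≡0) (*-zeroʳ (q (d u))))

    X-off : ∀ {u v} → adj G′ u v ≡ false → X u v ≡ 1
    X-off {u} {v} uv = off (adj G u v) (not (v == w)) (not (u == w)) uv (pairW G α u v) (q (d u) * q (d v)) (Δ * T)
      where
      off : ∀ b p r → (b ∧ p) ∧ r ≡ false → ∀ x k N → ((x ^ (⟦ b ⟧ * k)) ^ N when p when r) ≡ 1
      off b     p     false _ x k N = refl
      off b     false true  _ x k N = refl
      off false true  true  _ x k N = ^-zeroˡ N

    X-on : ∀ {u v} → adj G′ u v ≡ true → X u v ≡ (pairW G α u v ^ (q (d u) * q (d v))) ^ (Δ * T)
    X-on {u} {v} uv = on (adj G u v) (not (v == w)) (not (u == w)) uv (pairW G α u v) (q (d u) * q (d v)) (Δ * T)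
      where
      on : ∀ b p r → (b ∧ p) ∧ r ≡ true → ∀ x k N → ((x ^ (⟦ b ⟧ * k)) ^ N when p when r) ≡ (x ^ k) ^ N
      on true true true _ x k N = cong (λ y → (x ^ y) ^ N) (+-identityʳ k)

    pairExp-on : ∀ {u v} → adj G′ u v ≡ true → q (d′ u) * q (d′ v) ≡ pairExp G′ u v
    pairExp-on {u} {v} uv = trans (sym (+-identityʳ _)) (cong (λ b → ⟦ b ⟧ * (q (d′ u) * q (d′ v))) (sym uv))

    pairExp-off : ∀ {u v} → adj G′ u v ≡ false → 0 ≡ pairExp G′ u v
    pairExp-off {u} {v} uv = cong (λ b → ⟦ b ⟧ * (q (d′ u) * q (d′ v))) (sym uv)

    -- The degree of u drops by one and that of v is unchanged, so the new biclique lacks one vertex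
    -- of weight `α v`. The old count gets its old exponent from q (d′ u) * d′ u = T, and `R u` gets
    -- the share `r₂ u v` from q (d′ v) * d′ v = T.
    pair-neighbour : ∀ {u v} → adj G′ u v ≡ true → adj G u w ≡ true →
      Bound (q (d′ u) * q (d′ v)) (d′ v) (λ z → pairW G′ (α′ z) u v) (X u v * ρ₂ u v)
    pair-neighbour {u} {v} uv uw =
      Bound-resp {q (d′ u) * q (d′ v)} {c = d′ v} refl refl M≡ (cong₂ _*_ W-part R-part)
        (bound-neighbour (q (d′ u) * q (d′ v)) (d′ v) (d′ u) (α u) (α v) (d′≤Δ v) qb)
      where
      vw = far uv uw
      du = d-neighbour uw
      dv = d-other (isolate-avoidsʳ w G uv) vw
      b = suc (d′ u)
      qb : q b * b ≡ T
      qb = quot-T b z<s (subst (_≤ n) du (deg≤n G u))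
      M≡ : ∀ z → W (λ x → α u x * a z x) (α v) (d′ v) (d′ u) ≡ pairW G′ (α′ z) u v
      M≡ z = W-cong (d′ v) (d′ u) (λ x → sym (condition-neighbour w G α z uw x))
               (λ x → sym (condition-other w G α z (isolate-avoidsʳ w G uv) vw x))
      W-part : W (α u) (α v) (d′ v) b ^ (d′ u * Δ * (q b * (q (d′ u) * q (d′ v)))) ≡ X u v
      W-part = trans (cong₂ (λ x y → W (α u) (α v) x y ^ (d′ u * Δ * (q y * (q (d′ u) * q x)))) (sym dv) (sym du))
        (trans (cong (pairW G α u v ^_) (trans (eq (d′ u) Δ (q (d u)) (q (d′ u)) (q (d v)))
          (cong (λ t → q (d u) * q (d v) * (Δ * t)) (q-d′ (proj₁ (0<d′ uv))))))
        (trans (sym (^-*-assoc (pairW G α u v) (q (d u) * q (d v)) (Δ * T))) (sym (X-on uv))))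
        where eq : ∀ b Δ qb qb′ qc → b * Δ * (qb * (qb′ * qc)) ≡ qb * qc * (Δ * (qb′ * b))
              eq = solve-∀
      R-part : W (α w) (α u) b Δ ^ (d′ v * (q b * (q (d′ u) * q (d′ v)))) ≡ ρ₂ u v
      R-part = trans (cong (λ y → W (α w) (α u) y Δ ^ (d′ v * (q y * (q (d′ u) * q (d′ v))))) (sym du))
        (cong (R u ^_) (trans (eq (d′ v) (q (d u)) (q (d′ u)) (q (d′ v)))
          (cong (q (d u) *_) (trans (cong (q (d′ u) *_) (q-d′ (proj₂ (0<d′ uv)))) (sym (r₂-on uw uv))))))
        where eq : ∀ c qb qb′ qc → c * (qb * (qb′ * qc)) ≡ qb * (qb′ * (qc * c))
              eq = solve-∀

    X-sym : ∀ {u v} → adj G′ u v ≡ true → X v u ≡ X u v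
    X-sym {u} {v} uv = trans (X-on (trans (adj-sym G′ v u) uv))
      (trans (cong₂ (λ x y → (x ^ y) ^ (Δ * T)) (pairW-sym G α v u) (*-comm (q (d v)) (q (d u)))) (sym (X-on uv)))

    -- By `far` at most one of `ρ₂ u v` and `ρ₂ v u` is nontrivial; if v is the neighbour of w, the
    -- roles of u and v are exchanged.
    bound-pair : ∀ u v → Bound (e′ (inj₂ (u , v))) (c′ (inj₂ (u , v))) (M′ (inj₂ (u , v))) (β′ (inj₂ (u , v)))
    bound-pair u v = cases (adj G′ u v) refl (adj G u w) refl (adj G v w) refl
      where
      c≡ : ∀ {b₁ b₂} → adj G u w ≡ b₁ → adj G v w ≡ b₂ →
           (if b₁ then d′ v else if b₂ then d′ u else 0) ≡ c′ (inj₂ (u , v))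
      c≡ refl refl = refl
      cases : ∀ b₀ → adj G′ u v ≡ b₀ → ∀ b₁ → adj G u w ≡ b₁ → ∀ b₂ → adj G v w ≡ b₂ →
        Bound (e′ (inj₂ (u , v))) (c′ (inj₂ (u , v))) (M′ (inj₂ (u , v))) (β′ (inj₂ (u , v)))
      cases false uv _ _ _ _ = Bound-resp {c = c′ (inj₂ (u , v))} (pairExp-off uv) refl (λ _ → refl)
        (sym (cong₂ _*_ (X-off uv) (cong₂ _*_ (ρ₂-one (r₂-zeroʳ uv)) (ρ₂-one (r₂-zeroʳ (trans (adj-sym G′ v u) uv))))))
        (bound-trivial (c′ (inj₂ (u , v))) (M′ (inj₂ (u , v))))
      cases true uv true uw b₂ vw = Bound-resp (pairExp-on uv) (c≡ uw vw) (λ _ → refl)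
        (cong (X u v *_) (trans (sym (*-identityʳ _)) (cong (ρ₂ u v *_) (sym (ρ₂-one (r₂-zeroˡ u (far uv uw)))))))
        (pair-neighbour uv uw)
      cases true uv false uw true vw = Bound-resp (trans (*-comm (q (d′ v)) _) (pairExp-on uv)) (c≡ uw vw)
        (λ z → pairW-sym G′ (α′ z) v u)
        (cong₂ _*_ (X-sym uv) (trans (sym (*-identityˡ _)) (cong (_* ρ₂ v u) (sym (ρ₂-one (r₂-zeroˡ v uw))))))
        (pair-neighbour (trans (adj-sym G′ v u) uv) vw)
      cases true uv false uw false vw = Bound-resp (pairExp-on uv) (c≡ uw vw)
        (λ z → sym (W-cong (d′ v) (d′ u) (condition-other w G α z (isolate-avoidsˡ w G uv) uw)
                                         (condition-other w G α z (isolate-avoidsʳ w G uv) vw)))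
        β≡ (bound-constant (q (d′ u) * q (d′ v)) (W (α u) (α v) (d′ v) (d′ u)))
        where
        du = d-other (isolate-avoidsˡ w G uv) uw
        dv = d-other (isolate-avoidsʳ w G uv) vw
        β≡ : W (α u) (α v) (d′ v) (d′ u) ^ (q (d′ u) * q (d′ v) * (Δ * T)) ≡ β′ (inj₂ (u , v))
        β≡ = trans (cong₂ (λ x y → W (α u) (α v) x y ^ (q y * q x * (Δ * T))) (sym dv) (sym du))
          (trans (sym (^-*-assoc (pairW G α u v) (q (d u) * q (d v)) (Δ * T))) (trans (sym (X-on uv)) (trans (sym (*-identityʳ _))
            (cong (X u v *_) (sym (cong₂ _*_ (ρ₂-one (r₂-zeroˡ v uw)) (ρ₂-one (r₂-zeroˡ u vw))))))))

    bound-vertex : ∀ u → Bound (e′ (inj₁ u)) (c′ (inj₁ u)) (M′ (inj₁ u)) (β′ (inj₁ u))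
    bound-vertex u = cases (u ≟ w) (adj G u w) refl
      where
      N = Δ * T
      unused : ∀ {u} → d u ≢ 0 → (∑ zs (α u) ^ vertexExp G u) ^ N ≡ 1
      unused {u} du = trans (cong (λ x → (∑ zs (α u) ^ (x * D)) ^ N) (isZero-pos (n≢0⇒n>0 du))) (^-zeroˡ N)
      cases : Dec (u ≡ w) → ∀ b → adj G u w ≡ b → Bound (e′ (inj₁ u)) (c′ (inj₁ u)) (M′ (inj₁ u)) (β′ (inj₁ u))
      -- The indicator weight of w sums to 1, and Ψ G has no vertex factor for w because its degree
      -- is positive.
      cases (yes refl) b _ = Bound-resp {e = e′ (inj₁ u)} refl (cong ⟦_⟧ (sym (irrefl G u)))
        (λ z → sym (trans (∑-cong zs (λ x → trans (condition-at u G α z x) (sym (*-identityʳ _)))) (∑-at z (λ _ → 1))))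
        (trans (^-zeroˡ (e′ (inj₁ u) * N)) (sym (cong₂ _*_ (unused (>⇒≢ 0<Δ))
          (cong₂ _*_ (ρ₁-one (r₁-zero (irrefl G u))) (ρ₁-one (r₁-zero (irrefl G u)))))))
        (bound-constant (e′ (inj₁ u)) 1)
      cases (no u≢w) false uw = Bound-resp {e = e′ (inj₁ u)} refl (cong ⟦_⟧ (sym uw))
        (λ z → sym (∑-cong zs (condition-other w G α z u≢w uw)))
        (trans (cong (λ x → ∑ zs (α u) ^ (isZero x * D * N)) (sym (d-other u≢w uw)))
          (trans (sym (^-*-assoc (∑ zs (α u)) (vertexExp G u) N)) (trans (sym (*-identityʳ _))
            (cong ((∑ zs (α u) ^ vertexExp G u) ^ N *_) (sym (cong₂ _*_ (ρ₁-one (r₁-zero uw)) (ρ₁-one (r₁-zero uw))))))))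
        (bound-constant (e′ (inj₁ u)) (∑ zs (α u)))
      cases (no u≢w) true uw = isolated? (d′ u) refl
        where
        du = d-neighbour uw
        du≢0 : d u ≢ 0
        du≢0 du≡0 = contradiction (trans (sym du) du≡0) λ ()
        isolated? : ∀ k → d′ u ≡ k → Bound (e′ (inj₁ u)) (c′ (inj₁ u)) (M′ (inj₁ u)) (β′ (inj₁ u))
        isolated? (suc k) d′u = Bound-resp {c = c′ (inj₁ u)} (cong (λ x → isZero x * D) (sym d′u)) refl (λ _ → refl)
            (sym (cong₂ _*_ (unused du≢0) (cong₂ _*_ (ρ₁-one r₁≡0) (ρ₁-one r₁≡0))))
            (bound-trivial (c′ (inj₁ u)) (M′ (inj₁ u)))
          where
          r₁≡0 : r₁ u ≡ 0
          r₁≡0 = trans (cong (λ x → ⟦ adj G u w ⟧ * (isZero x * (T * T))) d′u) (*-zeroʳ ⟦ adj G u w ⟧)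
        -- Here u was a leaf attached to w. Its sum is a biclique of one vertex with an empty other
        -- side, whose weight is arbitrary; `α u` is put there.
        isolated? zero d′u = Bound-resp {e = D} (trans (sym (+-identityʳ D)) (cong (λ x → isZero x * D) (sym d′u)))
            (cong ⟦_⟧ (sym uw)) M≡ β≡
            (bound-neighbour D 1 0 (α u) (α u) 0<Δ (quot-T 1 z<s (subst (_≤ n) du≡1 (deg≤n G u))))
          where
          du≡1 : d u ≡ 1
          du≡1 = trans du (cong suc d′u)
          M≡ : ∀ z → W (λ x → α u x * a z x) (α u) 1 0 ≡ ∑ zs (α′ z u)
          M≡ z = trans (∑-cong (allMaps 1 m) (λ x → *-identityʳ _)) (trans (∑-allMaps-^ 1 (λ x → α u x * a z x))
            (trans (*-identityʳ _) (∑-cong zs (λ x → sym (condition-neighbour w G α z uw x)))))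
          r₁≡ : r₁ u ≡ T * T
          r₁≡ = trans (cong₂ (λ b x → ⟦ b ⟧ * (isZero x * (T * T))) uw d′u) (trans (+-identityʳ _) (+-identityʳ _))
          β≡ : W (α u) (α u) 1 1 ^ (0 * Δ * (q 1 * D)) * W (α w) (α u) 1 Δ ^ (1 * (q 1 * D)) ≡ β′ (inj₁ u)
          β≡ = cong₂ _*_ (sym (unused du≢0)) (trans (cong (λ x → W (α w) (α u) x Δ ^ (1 * (q x * D))) (sym du≡1))
            (trans (cong (R u ^_) (trans (eq (q (d u)) (T * T)) (cong (λ t → q (d u) * t + q (d u) * t) (sym r₁≡))))
              (^-distribˡ-+-* (R u) (q (d u) * r₁ u) _)))
            where eq : ∀ q t → 1 * (q * (2 * t)) ≡ q * t + q * t
                  eq = solve-∀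

    -- Either u has become isolated and `r₁` takes all of T², or each of its d′ u remaining edges
    -- takes T²/d′ u.
    row-sum : ∀ u → r₁ u + ∑ us (r₂ u) ≡ ⟦ adj G u w ⟧ * (T * T)
    row-sum u = trans (cong (r₁ u +_) (∑-*ˡ us ⟦ adj G u w ⟧ _)) (trans (sym (*-distribˡ-+ ⟦ adj G u w ⟧ _ _))
        (cong (⟦ adj G u w ⟧ *_) (trans (cong (isZero (d′ u) * (T * T) +_) (∑-*ʳ us (q (d′ u) * T) _)) (by-degree (d′ u) (deg≤n G′ u)))))
      where
      by-degree : ∀ k → k ≤ n → isZero k * (T * T) + k * (q k * T) ≡ T * T
      by-degree zero    _   = trans (+-identityʳ _) (+-identityʳ _)
      by-degree (suc k) k≤n = trans (eq (suc k) (q (suc k)) T) (cong (_* T) (quot-T (suc k) z<s k≤n))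
        where eq : ∀ k q t → k * (q * t) ≡ q * k * t
              eq = solve-∀

    weight-pair : ∀ u v → e′ (inj₂ (u , v)) * c′ (inj₂ (u , v)) ≡ r₂ u v + r₂ v u
    weight-pair u v = cases (adj G′ u v) refl (adj G u w) refl (adj G v w) refl
      where
      c≡ : ∀ {b₁ b₂} → adj G u w ≡ b₁ → adj G v w ≡ b₂ →
           c′ (inj₂ (u , v)) ≡ (if b₁ then d′ v else if b₂ then d′ u else 0)
      c≡ refl refl = refl
      eq₁ : ∀ x y c → x * y * c ≡ x * (y * c)
      eq₁ = solve-∀
      eq₂ : ∀ x y c → x * y * c ≡ y * (x * c)
      eq₂ = solve-∀
      cases : ∀ b₀ → adj G′ u v ≡ b₀ → ∀ b₁ → adj G u w ≡ b₁ → ∀ b₂ → adj G v w ≡ b₂ →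
        e′ (inj₂ (u , v)) * c′ (inj₂ (u , v)) ≡ r₂ u v + r₂ v u
      cases false uv _ _ _ _ = trans (cong (_* c′ (inj₂ (u , v))) (sym (pairExp-off uv)))
        (sym (cong₂ _+_ (r₂-zeroʳ uv) (r₂-zeroʳ (trans (adj-sym G′ v u) uv))))
      cases true uv true uw b₂ vw = trans (cong₂ _*_ (sym (pairExp-on uv)) (c≡ uw vw))
        (trans (eq₁ (q (d′ u)) (q (d′ v)) (d′ v)) (trans (cong (q (d′ u) *_) (q-d′ (proj₂ (0<d′ uv))))
          (trans (sym (+-identityʳ _)) (sym (cong₂ _+_ (r₂-on uw uv) (r₂-zeroˡ u (far uv uw)))))))
      cases true uv false uw true vw = trans (cong₂ _*_ (sym (pairExp-on uv)) (c≡ uw vw))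
        (trans (eq₂ (q (d′ u)) (q (d′ v)) (d′ u)) (trans (cong (q (d′ v) *_) (q-d′ (proj₁ (0<d′ uv))))
          (sym (cong₂ _+_ (r₂-zeroˡ v uw) (r₂-on vw (trans (adj-sym G′ v u) uv))))))
      cases true uv false uw false vw = trans (cong (e′ (inj₂ (u , v)) *_) (c≡ uw vw)) (trans (*-zeroʳ (e′ (inj₂ (u , v))))
        (sym (cong₂ _+_ (r₂-zeroˡ v uw) (r₂-zeroˡ u vw))))

    -- The balance of exponents required by `Duality`: each of the Δ neighbours of w contributes T²
    -- in each of two orientations.
    weights : ∑ indices (λ i → e′ i * c′ i) ≡ D * Δ
    weights = begin
        ∑ indices (λ i → e′ i * c′ i)
          ≡⟨ ∑-indices (λ i → e′ i * c′ i) ⟩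
        ∑ us (λ u → e′ (inj₁ u) * c′ (inj₁ u)) + ∑ us (λ u → ∑ us (λ v → e′ (inj₂ (u , v)) * c′ (inj₂ (u , v))))
          ≡⟨ cong₂ _+_ (∑-cong us (λ u → eq₁ (isZero (d′ u)) (T * T) ⟦ adj G u w ⟧))
               (∑-cong us (λ u → ∑-cong us (weight-pair u))) ⟩
        ∑ us (λ u → r₁ u + r₁ u) + ∑ us (λ u → ∑ us (λ v → r₂ u v + r₂ v u))
          ≡⟨ cong₂ _+_ (∑-+ us r₁ r₁) (trans (∑-cong us (λ u → ∑-+ us _ _)) (trans (∑-+ us _ _)
               (cong (∑ us (λ u → ∑ us (r₂ u)) +_) (∑-swap us us _)))) ⟩
        (∑ us r₁ + ∑ us r₁) + (∑ us (λ u → ∑ us (r₂ u)) + ∑ us (λ u → ∑ us (r₂ u)))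
          ≡⟨ +-interchange (∑ us r₁) (∑ us r₁) (∑ us (λ u → ∑ us (r₂ u))) _ ⟩
        _ ≡⟨ cong (λ x → x + x) (trans (sym (∑-+ us _ _)) (trans (∑-cong us row-sum)
               (trans (∑-*ʳ us (T * T) _) (cong (_* (T * T)) (∑-cong us (λ u → cong ⟦_⟧ (adj-sym G u w))))))) ⟩
        Δ * (T * T) + Δ * (T * T)
          ≡⟨ eq₂ Δ (T * T) ⟩
        D * Δ ∎
      where
      open ≡-Reasoning
      eq₁ : ∀ z t b → z * (2 * t) * b ≡ b * (z * t) + b * (z * t)
      eq₁ = solve-∀
      eq₂ : ∀ x t → x * t + x * t ≡ 2 * t * x
      eq₂ = solve-∀

    -- For a neighbour u the shares add up to the exponent q (d u) T² of `R u`; T = q Δ * Δ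
    -- identifies it with the exponent of (u, w) in `old`.
    ρ-row : ∀ u → ρ₁ u * ∏ us (ρ₂ u) ≡ old u w
    ρ-row u = begin
        ρ₁ u * ∏ us (ρ₂ u)
          ≡⟨ cong (ρ₁ u *_) (trans (∏-^∑ us (R u) _) (cong (R u ^_) (∑-*ˡ us (q (d u)) (r₂ u)))) ⟩
        R u ^ (q (d u) * r₁ u) * R u ^ (q (d u) * ∑ us (r₂ u))
          ≡⟨ trans (sym (^-distribˡ-+-* (R u) (q (d u) * r₁ u) _))
               (cong (R u ^_) (trans (sym (*-distribˡ-+ (q (d u)) (r₁ u) _)) (cong (q (d u) *_) (row-sum u)))) ⟩
        R u ^ (q (d u) * (⟦ adj G u w ⟧ * (T * T)))
          ≡⟨ cong₂ _^_ (W-sym (α w) (α u) (d u) Δ) (trans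
               (cong (λ t → q (d u) * (⟦ adj G u w ⟧ * (t * T))) (sym (quot-T Δ 0<Δ (deg≤n G w))))
               (eq (q (d u)) ⟦ adj G u w ⟧ (q Δ) Δ T)) ⟩
        pairW G α u w ^ (pairExp G u w * (Δ * T))
          ≡⟨ sym (^-*-assoc (pairW G α u w) (pairExp G u w) (Δ * T)) ⟩
        old u w ∎
      where
      open ≡-Reasoning
      eq : ∀ q b r x t → q * (b * (r * x * t)) ≡ b * (q * r) * (x * t)
      eq = solve-∀

    old-sym : ∀ u v → old u v ≡ old v u
    old-sym u v = cong₂ (λ x y → (x ^ y) ^ (Δ * T)) (pairW-sym G α u v)
      (cong₂ (λ b y → ⟦ b ⟧ * y) (adj-sym G u v) (*-comm (q (d u)) (q (d v))))

    ∏-β′ : ∏ indices β′ ≡ Ψ G α ^ (Δ * T)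
    ∏-β′ = begin
        ∏ indices β′
          ≡⟨ ∏-indices β′ ⟩
        ∏ us (λ u → β′ (inj₁ u)) * ∏ us (λ u → ∏ us (λ v → X u v * (ρ₂ u v * ρ₂ v u)))
          ≡⟨ cong₂ _*_
               (trans (∏-* us _ _) (cong₂ _*_ (∏-^ us _ N) (∏-* us ρ₁ ρ₁)))
               (trans (∏-cong us (λ u → trans (∏-* us _ _) (cong (∏ us (X u) *_) (∏-* us _ _))))
                 (trans (∏-* us _ _) (cong (XX *_) (trans (∏-* us _ _) (cong (P₂ *_) (∏-swap us us _)))))) ⟩
        V ^ N * (P₁ * P₁) * (XX * (P₂ * P₂))
          ≡⟨ eq (V ^ N) P₁ XX P₂ ⟩
        V ^ N * (XX * (P₁ * P₂ * (P₁ * P₂)))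
          ≡⟨ cong (λ x → V ^ N * (XX * x)) (cong₂ _*_ rows (trans rows (∏-cong us (λ u → old-sym u w)))) ⟩
        V ^ N * (XX * (∏ us (λ u → old u w) * ∏ us (old w)))
          ≡⟨ cong (V ^ N *_) (sym (∏-cross w old old-diag)) ⟩
        V ^ N * ∏ us (λ u → ∏ us (old u))
          ≡⟨ cong (V ^ N *_) (trans (∏-cong us (λ u → ∏-^ us _ N)) (∏-^ us _ N)) ⟩
        _ ≡⟨ sym (^-distribʳ-* N V _) ⟩
        Ψ G α ^ N ∎
      where
      open ≡-Reasoning
      N = Δ * T
      V = ∏ us (λ u → ∑ zs (α u) ^ vertexExp G u)
      XX = ∏ us (λ u → ∏ us (X u))
      P₁ = ∏ us ρ₁
      P₂ = ∏ us (λ u → ∏ us (ρ₂ u))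
      eq : ∀ v p x r → v * (p * p) * (x * (r * r)) ≡ v * (x * (p * r * (p * r)))
      eq = solve-∀
      rows : P₁ * P₂ ≡ ∏ us (λ u → old u w)
      rows = trans (sym (∏-* us _ _)) (∏-cong us ρ-row)
      old-diag : old w w ≡ 1
      old-diag = trans (cong (λ b → (pairW G α w w ^ (⟦ b ⟧ * (q (d w) * q (d w)))) ^ N) (irrefl G w)) (^-zeroˡ N)

    bound : ∀ i → Bound (e′ i) (c′ i) (M′ i) (β′ i)
    bound (inj₁ u)       = bound-vertex u
    bound (inj₂ (u , v)) = bound-pair u v

    0<D : 0 < D
    0<D = *-mono-≤ {1} {2} z<s (*-mono-≤ 0<T 0<T)

    step : (∀ z → h z ^ D ≤ Ψ G′ (α′ z)) → weightedHom G α ^ D ≤ Ψ G α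
    step ih = ^-cancelˡ-≤ (Δ * T) (*-mono-≤ 0<Δ 0<T) (begin
        (weightedHom G α ^ D) ^ (Δ * T) ≡⟨ cong (λ x → (x ^ D) ^ (Δ * T)) (weightedHom-condition w G α) ⟩
        (S ^ D) ^ (Δ * T)        ≡⟨ trans (^-*-assoc S D (Δ * T)) (cong (S ^_) (sym (*-assoc D Δ T))) ⟩
        S ^ (D * Δ * T)          ≤⟨ Duality.∑-bound zs (α w) h indices e′ c′ M′ β′ Δ T D 0<Δ 0<T 0<D c′≤Δ
                                      (λ z → ≤-trans (ih z) (≤-reflexive (sym (∏-indices _)))) weights bound ⟩
        ∏ indices β′             ≡⟨ ∏-β′ ⟩
        Ψ G α ^ (Δ * T)          ∎)
      where open ≤-Reasoning

  edgeless : ∀ G α → (∀ u → deg G u ≡ 0) → weightedHom G α ^ D ≤ Ψ G α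
  edgeless G α deg≡0 = ≤-reflexive (begin
      weightedHom G α ^ D
        ≡⟨ cong (_^ D) (trans (∑-cong (allMaps n m) (λ φ → trans (cong (∏ us (λ u → α u (φ u)) *_) (no-edges φ)) (*-identityʳ _)))
             (∑-allMaps-∏ n α)) ⟩
      ∏ us (λ u → ∑ zs (α u)) ^ D
        ≡⟨ sym (∏-^ us _ D) ⟩
      ∏ us (λ u → ∑ zs (α u) ^ D)
        ≡⟨ ∏-cong us (λ u → cong (∑ zs (α u) ^_) (trans (sym (+-identityʳ D)) (cong (λ x → isZero x * D) (sym (deg≡0 u))))) ⟩
      ∏ us (λ u → ∑ zs (α u) ^ vertexExp G u)
        ≡⟨ trans (sym (*-identityʳ _)) (cong (∏ us (λ u → ∑ zs (α u) ^ vertexExp G u) *_) (sym no-pairs)) ⟩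
      Ψ G α ∎)
    where
    open ≡-Reasoning
    nonadjacent : ∀ u v → adj G u v ≡ false
    nonadjacent u v with adj G u v in uv
    ... | false = refl
    ... | true  = contradiction (deg≡0 u) (>⇒≢ (adj⇒deg>0 G uv))
    all-one : ∀ {f : Fin n → Fin n → ℕ} → (∀ u v → f u v ≡ 1) → ∏ us (λ u → ∏ us (f u)) ≡ 1
    all-one f≡1 = trans (∏-cong us (λ u → trans (∏-cong us (f≡1 u)) (∏-one us))) (∏-one us)
    no-edges : ∀ φ → edges G φ ≡ 1
    no-edges φ = all-one (λ u v → cong (a (φ u) (φ v) when_) (nonadjacent u v))
    no-pairs : ∏ us (λ u → ∏ us (λ v → pairW G α u v ^ pairExp G u v)) ≡ 1
    no-pairs = all-one (λ u v → cong (λ b → pairW G α u v ^ (⟦ b ⟧ * (q (deg G u) * q (deg G v)))) (nonadjacent u v))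

  -- The weights are quantified after the graph because the induction hypothesis is applied to
  -- different weights for every colour z.
  weightedHom-bound : ∀ k G → ∑ us (deg G) < k → TriangleFree G → ∀ α → weightedHom G α ^ D ≤ Ψ G α
  weightedHom-bound (suc k) G <k tf α with max-or-zero (deg G)
  ... | inj₁ deg≡0              = edgeless G α deg≡0
  ... | inj₂ (w , 0<Δ , deg≤Δ) = Step.step G tf α w 0<Δ deg≤Δ (λ z →
    weightedHom-bound k (isolate w G) (<-≤-trans (∑-deg-isolate w G 0<Δ) (≤-pred <k)) (isolate-triangleFree w G tf) _)

-- Unweighted homomorphisms

countTrue-map : {A : Set} (p : A → Bool) (xs : List A) → countTrue (map p xs) ≡ ∑ xs (λ x → ⟦ p x ⟧)
countTrue-map p []       = refl
countTrue-map p (x ∷ xs) with p x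
... | true  = cong suc (countTrue-map p xs)
... | false = countTrue-map p xs

allB-∏ : {A : Set} (p : A → Bool) (xs : List A) → ⟦ allB p xs ⟧ ≡ ∏ xs (λ x → ⟦ p x ⟧)
allB-∏ p []       = refl
allB-∏ p (x ∷ xs) with p x
... | true  = trans (allB-∏ p xs) (sym (*-identityˡ _))
... | false = refl

⟦⟧-idem : ∀ b → ⟦ b ⟧ * ⟦ b ⟧ ≡ ⟦ b ⟧
⟦⟧-idem true  = refl
⟦⟧-idem false = refl

-- Built with `cons`, as the entries of `allMaps` are, so that sums over colourings split without
-- identifying pointwise equal maps.
joinMaps : ∀ {m} p {s} → (Fin p → Fin m) → (Fin s → Fin m) → Fin (p + s) → Fin m
joinMaps zero    x y = y
joinMaps (suc p) x y = cons (x Fin.zero) (joinMaps p (λ i → x (Fin.suc i)) y)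

joinMaps-↑ˡ : ∀ {m} p {s} (x : Fin p → Fin m) (y : Fin s → Fin m) i → joinMaps p x y (i ↑ˡ s) ≡ x i
joinMaps-↑ˡ (suc p) x y Fin.zero    = refl
joinMaps-↑ˡ (suc p) x y (Fin.suc i) = joinMaps-↑ˡ p (λ i → x (Fin.suc i)) y i

joinMaps-↑ʳ : ∀ {m} p {s} (x : Fin p → Fin m) (y : Fin s → Fin m) j → joinMaps p x y (p ↑ʳ j) ≡ y j
joinMaps-↑ʳ zero    x y j = refl
joinMaps-↑ʳ (suc p) x y j = joinMaps-↑ʳ p (λ i → x (Fin.suc i)) y j

∑-joinMaps : ∀ {m} p {s} (F : (Fin (p + s) → Fin m) → ℕ) →
  ∑ (allMaps (p + s) m) F ≡ ∑ (allMaps p m) (λ x → ∑ (allMaps s m) (λ y → F (joinMaps p x y)))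
∑-joinMaps         zero        F = sym (+-identityʳ _)
∑-joinMaps {m} (suc p) {s} F = begin
    ∑ (allMaps (suc p + s) m) F
      ≡⟨ ∑-allMaps-suc {n = p + s} F ⟩
    ∑ (allMaps (p + s) m) (λ φ → ∑ (allFin m) (λ c → F (cons c φ)))
      ≡⟨ ∑-joinMaps p _ ⟩
    ∑ (allMaps p m) (λ x → ∑ (allMaps s m) (λ y → ∑ (allFin m) (λ c → F (cons c (joinMaps p x y)))))
      ≡⟨ ∑-cong (allMaps p m) (λ x → ∑-swap (allMaps s m) (allFin m) _) ⟩
    ∑ (allMaps p m) (λ x → ∑ (allFin m) (λ c → ∑ (allMaps s m) (λ y → F (cons c (joinMaps p x y)))))
      ≡⟨ sym (∑-allMaps-suc {n = p} _) ⟩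
    ∑ (allMaps (suc p) m) (λ x → ∑ (allMaps s m) (λ y → F (joinMaps (suc p) x y))) ∎
  where open ≡-Reasoning

∏-allFin-+ : ∀ p {s} (f : Fin (p + s) → ℕ) →
  ∏ (allFin (p + s)) f ≡ ∏ (allFin p) (λ i → f (i ↑ˡ s)) * ∏ (allFin s) (λ j → f (p ↑ʳ j))
∏-allFin-+ zero    f = sym (*-identityˡ _)
∏-allFin-+ (suc p) {s} f = trans (∏-allFin-suc f) (trans (cong (f Fin.zero *_) (∏-allFin-+ p (λ u → f (Fin.suc u))))
  (trans (sym (*-assoc (f Fin.zero) _ _)) (cong (_* ∏ (allFin s) (λ j → f (suc p ↑ʳ j)))
    (sym (∏-allFin-suc (λ i → f (i ↑ˡ s)))))))

side-↑ˡ : ∀ {d} (i : Fin d) → side d (i ↑ˡ d) ≡ true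
side-↑ˡ {d} i = T⇒≡ (<⇒<ᵇ (subst (_< d) (sym (toℕ-↑ˡ i d)) (toℕ<n i)))
  where
  T⇒≡ : ∀ {b} → T b → b ≡ true
  T⇒≡ {true} _ = refl

side-↑ʳ : ∀ {d} (j : Fin d) → side d (d ↑ʳ j) ≡ false
side-↑ʳ {d} j with side d (d ↑ʳ j) in s
... | false = refl
... | true  = contradiction (<ᵇ⇒< (toℕ (d ↑ʳ j)) d (subst T (sym s) _))
                (≤⇒≯ (subst (d ≤_) (sym (toℕ-↑ʳ d j)) (m≤m+n d (toℕ j))))

module _ {m : ℕ} (H : LoopGraph m) where

  open SimpleGraph using (adj)

  edge : Fin m → Fin m → ℕ
  edge x y = ⟦ LoopGraph.adj H x y ⟧

  edge-sym : ∀ x y → edge x y ≡ edge y x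
  edge-sym x y = cong ⟦_⟧ (LoopGraph.sym H x y)

  open Colouring edge edge-sym (λ x y → ⟦⟧-idem (LoopGraph.adj H x y))

  hom≡weightedHom : ∀ {n} (G : SimpleGraph n) → hom G H ≡ weightedHom G (λ _ _ → 1)
  hom≡weightedHom {n} G = trans (countTrue-map (isHom G H) (allMaps n m)) (∑-cong (allMaps n m) (λ φ →
      trans (allB-∏ _ (allFin n)) (trans (∏-cong (allFin n) (λ u → trans (allB-∏ _ (allFin n))
        (∏-cong (allFin n) (λ v → implies (adj G u v) _))))
      (trans (sym (*-identityˡ _)) (cong (_* edges G φ) (sym (∏-one (allFin n))))))))
    where
    implies : ∀ b c → ⟦ not b ∨ c ⟧ ≡ (⟦ c ⟧ when b)
    implies true  c = refl
    implies false c = refl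

  -- Pairs within a side give the factor 1; a pair across the sides occurs in both orientations,
  -- which idempotence merges.
  edges-K : ∀ d (x y : Fin d → Fin m) →
    edges (K d) (joinMaps d x y) ≡ ∏ (allFin d) (λ i → ∏ (allFin d) (λ j → edge (x i) (y j)))
  edges-K d x y = begin
      edges (K d) φ
        ≡⟨ ∏-allFin-+ d _ ⟩
      ∏ ds (λ i → ∏ (allFin (d + d)) (f (i ↑ˡ d))) * ∏ ds (λ j → ∏ (allFin (d + d)) (f (d ↑ʳ j)))
        ≡⟨ cong₂ _*_ (∏-cong ds left) (∏-cong ds right) ⟩
      ∏ ds (λ i → ∏ ds (λ j → edge (x i) (y j))) * ∏ ds (λ j → ∏ ds (λ i → edge (x i) (y j)))
        ≡⟨ cong (∏ ds (λ i → ∏ ds (λ j → edge (x i) (y j))) *_) (∏-swap ds ds _) ⟩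
      ∏ ds (λ i → ∏ ds (λ j → edge (x i) (y j))) * ∏ ds (λ i → ∏ ds (λ j → edge (x i) (y j)))
        ≡⟨ trans (sym (∏-* ds _ _)) (∏-cong ds (λ i → trans (sym (∏-* ds _ _))
             (∏-cong ds (λ j → ⟦⟧-idem (LoopGraph.adj H (x i) (y j)))))) ⟩
      ∏ ds (λ i → ∏ ds (λ j → edge (x i) (y j))) ∎
    where
    open ≡-Reasoning
    ds = allFin d
    φ = joinMaps d x y
    f : Fin (d + d) → Fin (d + d) → ℕ
    f u v = edge (φ u) (φ v) when adj (K d) u v
    left : ∀ i → ∏ (allFin (d + d)) (f (i ↑ˡ d)) ≡ ∏ ds (λ j → edge (x i) (y j))
    left i = trans (∏-allFin-+ d _) (trans (cong₂ _*_
      (trans (∏-cong ds (λ j → cong₂ (λ b c → edge (φ (i ↑ˡ d)) (φ (j ↑ˡ d)) when xorB b c) (side-↑ˡ i) (side-↑ˡ j))) (∏-one ds))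
      (∏-cong ds (λ j → trans (cong₂ (λ b c → edge (φ (i ↑ˡ d)) (φ (d ↑ʳ j)) when xorB b c) (side-↑ˡ i) (side-↑ʳ j))
        (cong₂ edge (joinMaps-↑ˡ d x y i) (joinMaps-↑ʳ d x y j)))))
      (*-identityˡ _))
    right : ∀ j → ∏ (allFin (d + d)) (f (d ↑ʳ j)) ≡ ∏ ds (λ i → edge (x i) (y j))
    right j = trans (∏-allFin-+ d _) (trans (cong₂ _*_
      (∏-cong ds (λ i → trans (cong₂ (λ b c → edge (φ (d ↑ʳ j)) (φ (i ↑ˡ d)) when xorB b c) (side-↑ʳ j) (side-↑ˡ i))
        (trans (cong₂ edge (joinMaps-↑ʳ d x y j) (joinMaps-↑ˡ d x y i)) (edge-sym (y j) (x i)))))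
      (trans (∏-cong ds (λ i → cong₂ (λ b c → edge (φ (d ↑ʳ j)) (φ (d ↑ʳ i)) when xorB b c) (side-↑ʳ j) (side-↑ʳ i))) (∏-one ds)))
      (*-identityʳ _))

  hom-K : ∀ d → hom (K d) H ≡ W (λ _ → 1) (λ _ → 1) d d
  hom-K d = trans (hom≡weightedHom (K d)) (trans (∑-joinMaps d _) (trans
      (∑-cong (allMaps d m) (λ x → ∑-cong (allMaps d m) (λ y → cong₂ _*_ (∏-one (allFin (d + d)))
        (trans (edges-K d x y) (∏-swap (allFin d) (allFin d) _)))))
    (sym (trans (W-expand (λ _ → 1) (λ _ → 1) d d) (∑-cong (allMaps d m) (λ x → ∑-cong (allMaps d m) (λ y →
      cong₂ _*_ (∏-one (allFin d)) (trans (cong (_* ∏ (allFin d) (λ j → ∏ (allFin d) (λ i → edge (x i) (y j)))) (∏-one (allFin d))) (*-identityˡ _)))))))))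

-- The case of a regular graph

theorem1p8 : (d : ℕ) → 1 ≤ d → (n : ℕ) → (G : SimpleGraph (suc n)) →
    TriangleFree G → Regular d G →
    (m : ℕ) → (H : LoopGraph m) →
    hom G H ^ (2 * d) ≤ hom (K d) H ^ (suc n)
theorem1p8 d 0<d n G tf regular m H = ^-cancelˡ-≤ k 0<k (begin
    (hom G H ^ (2 * d)) ^ k
      ≡⟨ trans (cong (λ x → (x ^ (2 * d)) ^ k) (hom≡weightedHom H G)) (trans (^-*-assoc (weightedHom G 𝟙) (2 * d) k)
           (cong (weightedHom G 𝟙 ^_) (trans (e₁ d (q d)) (cong (λ t → 2 * (t * t)) qd)))) ⟩
    weightedHom G 𝟙 ^ D
      ≤⟨ weightedHom-bound (suc (∑ us (deg G))) G ≤-refl tf 𝟙 ⟩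
    Ψ G 𝟙
      ≡⟨ cong₂ _*_ no-isolated pairs ⟩
    1 * 𝐖 ^ (N * k)
      ≡⟨ trans (*-identityˡ _) (trans (sym (^-*-assoc 𝐖 N k)) (cong (λ x → (x ^ N) ^ k) (sym (hom-K H d)))) ⟩
    (hom (K d) H ^ N) ^ k ∎)
  where
  open ≤-Reasoning
  N = suc n
  divides-N! : ∀ c → 0 < c → c ≤ N → c ∣ N !
  divides-N! (suc c) _ c≤N = ∣-trans (m∣m*n (c !)) (m≤n⇒m!∣n! c≤N)
  -- N! is a multiple of every positive degree, as no degree exceeds N.
  open Potential (edge H) (edge-sym H) (λ x y → ⟦⟧-idem (LoopGraph.adj H x y)) N (N !) (1≤n! N)
    (λ c 0<c c≤N → quot-* (1≤n! N) (divides-N! c 0<c c≤N))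
  𝟙 : Weights
  𝟙 _ _ = 1
  𝐖 : ℕ
  𝐖 = W (λ _ → 1) (λ _ → 1) d d
  -- The common exponent to be cancelled: D = 2 d k, and each of the N vertices contributes 𝐖^k to Ψ
  -- through its d neighbours.
  k : ℕ
  k = d * (q d * q d)
  deg≡d : ∀ u → deg G u ≡ d
  deg≡d u = trans (sym (countTrue-map (SimpleGraph.adj G u) us)) (regular u)
  qd : q d * d ≡ N !
  qd = quot-* (1≤n! N) (divides-N! d 0<d (subst (_≤ N) (deg≡d Fin.zero) (deg≤n G Fin.zero)))
  0<qd : 0 < q d
  0<qd = n≢0⇒n>0 λ q≡0 → >⇒≢ (1≤n! N) (trans (sym qd) (cong (_* d) q≡0))
  0<k : 0 < k
  0<k = *-mono-≤ 0<d (*-mono-≤ 0<qd 0<qd)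
  e₁ : ∀ d q → 2 * d * (d * (q * q)) ≡ 2 * (q * d * (q * d))
  e₁ = solve-∀
  no-isolated : ∏ us (λ u → ∑ zs (λ _ → 1) ^ vertexExp G u) ≡ 1
  no-isolated = trans (∏-cong us (λ u → cong (λ x → ∑ zs (λ _ → 1) ^ (x * D))
    (isZero-pos (subst (0 <_) (sym (deg≡d u)) 0<d)))) (∏-one us)
  pairs : ∏ us (λ u → ∏ us (λ v → pairW G 𝟙 u v ^ pairExp G u v)) ≡ 𝐖 ^ (N * k)
  pairs = trans (∏-cong us row) (trans (∏-allFin-const N (𝐖 ^ k)) (trans (^-*-assoc 𝐖 k N) (cong (𝐖 ^_) (*-comm k N))))
    where
    row : ∀ u → ∏ us (λ v → pairW G 𝟙 u v ^ pairExp G u v) ≡ 𝐖 ^ k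
    row u = trans (∏-cong us (λ v → cong₂ (λ x y → W (λ _ → 1) (λ _ → 1) y x ^ (⟦ SimpleGraph.adj G u v ⟧ * (q x * q y))) (deg≡d u) (deg≡d v)))
      (trans (∏-^∑ us 𝐖 (λ v → ⟦ SimpleGraph.adj G u v ⟧ * (q d * q d))) (cong (𝐖 ^_)
        (trans (∑-*ʳ us (q d * q d) (λ v → ⟦ SimpleGraph.adj G u v ⟧)) (cong (_* (q d * q d)) (deg≡d u)))))
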